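{- Let $\mathcal{G}_3$ be the family of subcubic graphs (graphs of maximum degree at most $3$). For all $(m,n)\ne(0,1)$ we have: (i) $\omega_{a(1,0)}(\mathcal{G}_3)=\omega_{r(1,0)}(\mathcal{G}_3)=7$; (ii) $\omega_{a(0,n)}(\mathcal{G}_3)=\omega_{r(0,n)}(\mathcal{G}_3)=8$ for $n=2,3$; (iii) $\omega_{a(m,n)}(\mathcal{G}_3)=\omega_{r(m,n)}(\mathcal{G}_3)=10$ for $(m,n)=(1,1)$ and for all integers $m,n\ge0$ with $2m+n\ge 4$.
   Context: All graphs are finite. For integers $m,n\ge0$, an $(m,n)$-graph $G$ has a simple underlying undirected graph $und(G)$, in which each adjacency is either an arc (directed) of one of $m$ types, labeled $1,\dots,m$, or an (undirected) edge of one of $n$ types, labeled $m+1,\dots,m+n$. The label function is $\sigma$: for an arc $uv$ (from $u$ to $v$) of label $k$, $\sigma(uv)=k$ and $\sigma(vu)=-k$; for an edge $uv$ of label $k$, $\sigma(uv)=\sigma(vu)=k$. A homomorphism $f:G\to H$ of $(m,n)$-graphs is a map $f:V(G)\to V(H)$ such that for each arc/edge $uv$ of $G$, $f(u)f(v)$ is an arc/edge of $H$ with $\sigma(f(u)f(v))=\sigma(uv)$. The $(m,n)$-chromatic number $\chi_{m,n}(G)$ is the minimum of $|V(H)|$ over all $(m,n)$-graphs $H$ admitting a homomorphism $G\to H$. An $(m,n)$-relative clique of $G$ is a set $R\subseteq V(G)$ such that $f(u)\ne f(v)$ for all distinct $u,v\in R$ and every homomorphism $f$ of $G$ to any $(m,n)$-graph;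 $\omega_{r(m,n)}(G)$ is the maximum cardinality of an $(m,n)$-relative clique of $G$. An $(m,n)$-absolute clique is an $(m,n)$-graph $A$ with $\chi_{m,n}(A)=|V(A)|$; $\omega_{a(m,n)}(G)$ is the maximum of $|V(A)|$ over subgraphs $A$ of $G$ that are $(m,n)$-absolute cliques. For a family $\mathcal{F}$ of simple graphs and $p\in\{\omega_{r(m,n)},\omega_{a(m,n)}\}$, $p(\mathcal{F})=\max\{p(G): und(G)\in\mathcal{F}\}$. Part (i) is credited in the source to earlier work of Das, Prabhu and Sen. -}

module Defs where

open import Data.Bool using (Bool; true; false)
open import Data.Fin using (Fin)
open import Data.Fin.Subset using (Subset; _∈_; ∣_∣)
open import Data.Maybe using (Maybe; just; nothing; is-just)
import Data.Maybe as Maybe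
open import Data.Nat using (ℕ; _≤_)
open import Data.Product using (Σ; ∃; _×_)
open import Data.Vec using (tabulate)
open import Function.Definitions using (Injective)
open import Relation.Binary.PropositionalEquality using (_≡_; _≢_; refl; trans; cong)

IsMaximum : (ℕ → Set) → ℕ → Set
IsMaximum P k = P k × (∀ j → P j → j ≤ k)

IsMinimum : (ℕ → Set) → ℕ → Set
IsMinimum P k = P k × (∀ j → P j → k ≤ j)

record SimpleGraph : Set where
  field
    order     : ℕ
    adjacent  : Fin order → Fin order → Bool
    loopless  : ∀ u → adjacent u u ≡ false
    symmetric : ∀ u v → adjacent v u ≡ adjacent u v

  degree : Fin order → ℕ
  degree u = ∣ tabulate (adjacent u) ∣

GraphFamily : Set₁
GraphFamily = SimpleGraph → Set

Subcubic : GraphFamily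
Subcubic Γ = ∀ u → degree u ≤ 3
  where open SimpleGraph Γ

-- The values of σ: arc⁺ k and arc⁻ k are the signed labels +k and -k of an arc
-- of type k, read along and against its direction; edge k is the label m + k.
data Label (m n : ℕ) : Set where
  arc⁺ : Fin m → Label m n
  arc⁻ : Fin m → Label m n
  edge : Fin n → Label m n

reverse : ∀ {m n} → Label m n → Label m n
reverse (arc⁺ k) = arc⁻ k
reverse (arc⁻ k) = arc⁺ k
reverse (edge k) = edge k

-- σ u v ≡ nothing means that u and v are not adjacent.
record MixedGraph (m n : ℕ) : Set where
  field
    order      : ℕ
    σ          : Fin order → Fin order → Maybe (Label m n)
    σ-loopless : ∀ u → σ u u ≡ nothing
    σ-reverse  : ∀ u v → σ v u ≡ Maybe.map reverse (σ u v)

open MixedGraph public using (order)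

module _ {m n : ℕ} where

  und : MixedGraph m n → SimpleGraph
  und G = record
    { order     = G.order
    ; adjacent  = λ u v → is-just (G.σ u v)
    ; loopless  = λ u → cong is-just (G.σ-loopless u)
    ; symmetric = λ u v → trans (cong is-just (G.σ-reverse u v)) (is-just-map (G.σ u v))
    }
    where
    module G = MixedGraph G
    is-just-map : (l : Maybe (Label m n)) → is-just (Maybe.map reverse l) ≡ is-just l
    is-just-map (just _) = refl
    is-just-map nothing  = refl

  IsHomomorphism : (G H : MixedGraph m n) → (Fin (order G) → Fin (order H)) → Set
  IsHomomorphism G H f = ∀ u v l → G.σ u v ≡ just l → H.σ (f u) (f v) ≡ just l
    where
    module G = MixedGraph G
    module H = MixedGraph H

  -- χ_{m,n}(G) = k
  ChromaticNumber : MixedGraph m n → ℕ → Set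
  ChromaticNumber G = IsMinimum λ j →
    Σ (MixedGraph m n) λ H → order H ≡ j × ∃ (IsHomomorphism G H)

  IsRelativeClique : (G : MixedGraph m n) → Subset (order G) → Set
  IsRelativeClique G R =
    ∀ u v → u ∈ R → v ∈ R → u ≢ v →
    ∀ (H : MixedGraph m n) f → IsHomomorphism G H f → f u ≢ f v

  IsAbsoluteClique : MixedGraph m n → Set
  IsAbsoluteClique A = ChromaticNumber A (order A)

  -- Vertex sets are of the form Fin k, so a (not necessarily induced) subgraph
  -- is given together with its inclusion map.
  IsSubgraph : MixedGraph m n → MixedGraph m n → Set
  IsSubgraph A G = ∃ λ (ι : Fin (order A) → Fin (order G)) →
    Injective _≡_ _≡_ ι × IsHomomorphism A G ι

  -- ω_{r(m,n)}(G) = k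
  RelativeCliqueNumber : MixedGraph m n → ℕ → Set
  RelativeCliqueNumber G = IsMaximum λ j →
    ∃ λ (R : Subset (order G)) → IsRelativeClique G R × ∣ R ∣ ≡ j

  -- ω_{a(m,n)}(G) = k
  AbsoluteCliqueNumber : MixedGraph m n → ℕ → Set
  AbsoluteCliqueNumber G = IsMaximum λ j →
    Σ (MixedGraph m n) λ A → IsSubgraph A G × IsAbsoluteClique A × order A ≡ j

  -- p(F) = k, for a graph parameter p given by its graph: p G j means p(G) = j.
  FamilyMaximum : (MixedGraph m n → ℕ → Set) → GraphFamily → ℕ → Set
  FamilyMaximum p F = IsMaximum λ j →
    Σ (MixedGraph m n) λ G → F (und G) × p G j

ω-a[_,_] : (m n : ℕ) → GraphFamily → ℕ → Set
ω-a[ m , n ] = FamilyMaximum (AbsoluteCliqueNumber {m} {n})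

ω-r[_,_] : (m n : ℕ) → GraphFamily → ℕ → Set
ω-r[ m , n ] = FamilyMaximum (RelativeCliqueNumber {m} {n})

{-# OPTIONS --safe #-}
-- Two vertices are kept apart by every homomorphism exactly when they are adjacent
-- or have a common neighbour seeing them with different labels (a special 2-path);
-- otherwise they can be merged.  So both clique numbers are governed by families
-- of vertices that are pairwise joined in this sense, and in a subcubic graph such
-- a family lies in a ball of radius 2, which gives the bound 10.
--
-- With at most three edge types, suppose nine vertices R are pairwise joined.  If R
-- is closed under neighbours, it induces a cubic graph of odd order.  Otherwise
-- some w outside R has a neighbour in R, the radius-2 balls around the three
-- neighbours of w are then as large as possible, and R ∪ {w} is the Petersen graph,
-- properly coloured away from w.  The six vertices at distance 2 from w form a
-- hexagon whose antipodal vertices share a neighbour of w, and the colouring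
-- conditions around this hexagon are contradictory.
--
-- In an oriented graph the special 2-paths are the directed ones.  For eight
-- pairwise joined vertices, counting arcs and directed 2-paths is tight: the
-- eight vertices span a cubic graph, every non-adjacent pair has exactly one
-- directed 2-path and no adjacent pair has any.  Let A and B be the sets of vertices
-- of out-degree 2 and 1.  Both have four elements, an arc inside A would extend to
-- a directed path on five vertices of A, and dually for B, so the graph is bipartite
-- and each vertex of A would be adjacent to all four of B, exceeding degree 3.
module Submission where

open import Data.Bool using (Bool; true; false; not)
open import Data.Empty using (⊥)
open import Data.Fin using (Fin; zero; suc; punchIn; punchOut; inject≤; _≟_)
open import Data.Fin.Patterns
open import Data.Fin.Properties using (any?; all?; punchIn-punchOut; punchOut-injective; injective⇒≤; inject≤-injective; suc-injective)
open import Data.Fin.Subset using (Subset; _∈_; ∣_∣; ⊤; _-_)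
open import Data.Fin.Subset.Properties using (∣p∣≤n; ∣⊤∣≡n; x∈p∧x≢y⇒x∈p-y; x∈p⇒∣p-x∣<∣p∣; p─q⊆p)
open import Data.List using (List; []; _∷_)
open import Data.Maybe using (Maybe; just; nothing; is-just; _<∣>_)
import Data.Maybe as Maybe
open import Data.Maybe.Properties using (just-injective; ≡-dec)
open import Data.Nat using (ℕ; zero; suc; _+_; _*_; _≤_; _<_; _≤?_; z≤n; s≤s; s≤s⁻¹)
import Data.Nat as ℕ
open import Data.Nat.Divisibility using (_∣_; _∣?_; ∣m∣n⇒∣m+n; divides)
open import Data.Nat.Properties using (≤-refl; ≤-reflexive; ≤-trans; ≤-antisym; ≰⇒>; ≤⇒≯; n≤1+n; n≮n; m≤m+n; m≤n+m; +-comm; +-suc; *-comm; *-suc; *-zeroʳ; *-identityʳ; *-distribˡ-+; +-mono-≤; +-monoˡ-≤; +-monoʳ-≤; *-monoʳ-≤; +-cancelˡ-≤; +-cancelʳ-≤; *-cancelˡ-≤; +-cancelˡ-≡; *-cancelˡ-≡; +-*-semiring; module ≤-Reasoning)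
open import Algebra.Properties.Semiring.Sum +-*-semiring using (sum; sum-syntax; sum-cong-≗; ∑-distrib-+; ∑-comm; *-distribˡ-sum; *-distribʳ-sum)
open import Data.Nat.Tactic.RingSolver using (solve-∀)
open import Data.Product using (Σ; ∃; ∃₂; _×_; _,_; proj₁; proj₂)
open import Data.Sum using (_⊎_; inj₁; inj₂; [_,_]′)
open import Data.Vec using (Vec; []; _∷_; here; there; tabulate; lookup; replicate)
open import Data.Vec.Properties using (tabulate-cong; lookup∘tabulate; lookup⇒[]=; []=⇒lookup)
import Data.Vec.Membership.Propositional as Vec
open import Data.Vec.Membership.Propositional.Properties using (∈-lookup)
open import Data.Vec.Relation.Unary.All as All using (All; []; _∷_)
open import Data.Vec.Relation.Unary.All.Properties using (lookup⁺)
open import Data.Vec.Relation.Unary.AllPairs using ([]; _∷_)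
open import Data.Vec.Relation.Unary.Any using (here; there; index)
open import Data.Vec.Relation.Unary.Any.Properties using (lookup-index)
open import Data.Vec.Relation.Unary.Unique.Propositional using (Unique)
open import Data.Vec.Relation.Unary.Unique.Propositional.Properties using () renaming (lookup-injective to unique⇒lookup-injective)
open import Function using (id; _∘_)
open import Function.Definitions using (Injective)
open import Relation.Binary.Definitions using (DecidableEquality)
open import Relation.Binary.PropositionalEquality using (_≡_; _≢_; _≗_; refl; sym; trans; cong; cong₂; subst; subst₂; module ≡-Reasoning)
open import Relation.Nullary using (¬_; Dec; yes; no; does; contradiction; ¬?; map′; True; toWitness)
open import Relation.Nullary.Decidable using (_⊎-dec_; _×-dec_; from-yes; from-no; decidable-stable)
open import Defs

private
  variable
    m n : ℕ

-- Labels and joined vertices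

_≟ᴸ_ : DecidableEquality (Label m n)
arc⁺ j ≟ᴸ arc⁺ k = map′ (cong arc⁺) (λ { refl → refl }) (j ≟ k)
arc⁺ _ ≟ᴸ arc⁻ _ = no λ ()
arc⁺ _ ≟ᴸ edge _ = no λ ()
arc⁻ _ ≟ᴸ arc⁺ _ = no λ ()
arc⁻ j ≟ᴸ arc⁻ k = map′ (cong arc⁻) (λ { refl → refl }) (j ≟ k)
arc⁻ _ ≟ᴸ edge _ = no λ ()
edge _ ≟ᴸ arc⁺ _ = no λ ()
edge _ ≟ᴸ arc⁻ _ = no λ ()
edge j ≟ᴸ edge k = map′ (cong edge) (λ { refl → refl }) (j ≟ k)

reverse-involutive : (l : Label m n) → reverse (reverse l) ≡ l
reverse-involutive (arc⁺ _) = refl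
reverse-involutive (arc⁻ _) = refl
reverse-involutive (edge _) = refl

reverse-injective : {k l : Label m n} → reverse k ≡ reverse l → k ≡ l
reverse-injective {k = k} {l} eq =
  trans (sym (reverse-involutive k)) (trans (cong reverse eq) (reverse-involutive l))

Differ : Maybe (Label m n) → Maybe (Label m n) → Set
Differ x y = ∃₂ λ k l → x ≡ just k × y ≡ just l × k ≢ l

differ? : (x y : Maybe (Label m n)) → Dec (Differ x y)
differ? (just k) (just l) =
  map′ (λ k≢l → k , l , refl , refl , k≢l) (λ { (_ , _ , refl , refl , k≢l) → k≢l }) (¬? (k ≟ᴸ l))
differ? (just _) nothing  = no λ { (_ , _ , _ , () , _) }
differ? nothing  _        = no λ { (_ , _ , () , _) }

module Joining (G : MixedGraph m n) where
  open MixedGraph G using (σ; σ-loopless; σ-reverse)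

  V : Set
  V = Fin (order G)

  Adj : V → V → Set
  Adj u v = ∃ λ l → σ u v ≡ just l

  -- Both labels are read outwards from the middle vertex, so a directed path u → w → v shows as
  -- `arc⁻` and `arc⁺` at w, whereas two arcs of one type leaving w agree.
  Special : V → V → Set
  Special u v = ∃ λ w → Differ (σ w u) (σ w v)

  Joined : V → V → Set
  Joined u v = Adj u v ⊎ Special u v

  adj? : ∀ u v → Dec (Adj u v)
  adj? u v with σ u v
  ... | just l  = yes (l , refl)
  ... | nothing = no λ ()

  joined? : ∀ u v → Dec (Joined u v)
  joined? u v = adj? u v ⊎-dec any? (λ w → differ? (σ w u) (σ w v))

  σ-flip : ∀ {u v l} → σ u v ≡ just l → σ v u ≡ just (reverse l)
  σ-flip {u} {v} eq = trans (σ-reverse u v) (cong (Maybe.map reverse) eq)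

  adj-sym : ∀ {u v} → Adj u v → Adj v u
  adj-sym (_ , eq) = _ , σ-flip eq

  adj-irrefl : ∀ {u v} → Adj u v → u ≢ v
  adj-irrefl {u} (_ , eq) refl with () ← trans (sym eq) (σ-loopless u)

  joined-irrefl : ∀ {u v} → Joined u v → u ≢ v
  joined-irrefl (inj₁ uv) = adj-irrefl uv
  joined-irrefl (inj₂ (_ , _ , _ , p , q , k≢l)) refl =
    k≢l (just-injective (trans (sym p) q))

  Clique : ∀ {k} → (Fin k → V) → Set
  Clique c = ∀ i j → i ≢ j → Joined (c i) (c j)

  clique-injective : ∀ {k} {c : Fin k → V} → Clique c → Injective _≡_ _≡_ c
  clique-injective cl {i} {j} eq with i ≟ j
  ... | yes i≡j = i≡j
  ... | no  i≢j = contradiction eq (joined-irrefl (cl i j i≢j))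

open Joining

-- A homomorphism carries the middle vertex and both labels along, so different labels stay
-- different. With `joined-irrefl` this keeps joined vertices apart.
joined-hom : (G H : MixedGraph m n) {f : Fin (order G) → Fin (order H)} →
             IsHomomorphism G H f → ∀ {u v} → Joined G u v → Joined H (f u) (f v)
joined-hom G H hom (inj₁ (l , eq)) = inj₁ (l , hom _ _ l eq)
joined-hom G H {f} hom (inj₂ (w , k , l , p , q , k≢l)) =
  inj₂ (f w , k , l , hom _ _ k p , hom _ _ l q , k≢l)

-- Merging two vertices that are not joined

module Merge (G : MixedGraph m n) {u v : Fin (order G)} (¬uv : ¬ Joined G u v) where
  open MixedGraph G using (σ; σ-loopless; σ-reverse)

  -- Only entries involving u change: u takes over the labels of v. The vertex v stays, which avoids
  -- renumbering; `fold` misses it when u and v are distinct. The preference of `<∣>` for its first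
  -- argument is harmless by `agree`.
  τ : V G → V G → Maybe (Label m n)
  τ x y with x ≟ u | y ≟ u
  ... | yes _ | yes _ = nothing
  ... | yes _ | no  _ = σ u y <∣> σ v y
  ... | no  _ | yes _ = σ x u <∣> σ x v
  ... | no  _ | no  _ = σ x y

  map-<∣> : (a b : Maybe (Label m n)) →
            Maybe.map reverse a <∣> Maybe.map reverse b ≡ Maybe.map reverse (a <∣> b)
  map-<∣> (just _) _ = refl
  map-<∣> nothing  _ = refl

  τ-loopless : ∀ x → τ x x ≡ nothing
  τ-loopless x with x ≟ u
  ... | yes _ = refl
  ... | no  _ = σ-loopless x

  τ-reverse : ∀ x y → τ y x ≡ Maybe.map reverse (τ x y)
  τ-reverse x y with x ≟ u | y ≟ u
  ... | yes _ | yes _ = refl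
  ... | yes _ | no  _ rewrite σ-reverse u y | σ-reverse v y = map-<∣> (σ u y) (σ v y)
  ... | no  _ | yes _ rewrite σ-reverse x u | σ-reverse x v = map-<∣> (σ x u) (σ x v)
  ... | no  _ | no  _ = σ-reverse x y

  merged : MixedGraph m n
  merged = record { order = order G ; σ = τ ; σ-loopless = τ-loopless ; σ-reverse = τ-reverse }

  fold : V G → V G
  fold x with x ≟ v
  ... | yes _ = u
  ... | no  _ = x

  fold-v : fold v ≡ u
  fold-v with v ≟ v
  ... | yes _   = refl
  ... | no  v≢v = contradiction refl v≢v

  fold-other : ∀ {x} → x ≢ v → fold x ≡ x
  fold-other {x} x≢v with x ≟ v
  ... | yes x≡v = contradiction x≡v x≢v
  ... | no  _   = refl

  Identified : V G → Set
  Identified x = x ≡ u ⊎ x ≡ v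

  fold≡u : ∀ {x} → fold x ≡ u → Identified x
  fold≡u {x} eq with x ≟ v
  ... | yes x≡v = inj₂ x≡v
  ... | no  _   = inj₁ eq

  fold≢u : ∀ {x} → fold x ≢ u → fold x ≡ x
  fold≢u {x} neq with x ≟ v
  ... | yes _ = contradiction refl neq
  ... | no  _ = refl

  ¬both-identified : ∀ {x y l} → Identified x → Identified y → σ x y ≢ just l
  ¬both-identified (inj₁ refl) (inj₁ refl) eq with () ← trans (sym eq) (σ-loopless u)
  ¬both-identified (inj₁ refl) (inj₂ refl) eq = ¬uv (inj₁ (_ , eq))
  ¬both-identified (inj₂ refl) (inj₁ refl) eq = ¬uv (inj₁ (adj-sym G (_ , eq)))
  ¬both-identified (inj₂ refl) (inj₂ refl) eq with () ← trans (sym eq) (σ-loopless v)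

  -- Two different labels seen from w would form a special 2-path between u and v.
  agree : ∀ {w k l} → σ w u ≡ just k → σ w v ≡ just l → k ≡ l
  agree {w} {k} {l} p q with k ≟ᴸ l
  ... | yes k≡l = k≡l
  ... | no  k≢l = contradiction (inj₂ (w , k , l , p , q , k≢l)) ¬uv

  towards : ∀ {x y l} → Identified y → σ x y ≡ just l → (σ x u <∣> σ x v) ≡ just l
  towards {x} (inj₁ refl) eq rewrite eq = refl
  towards {x} (inj₂ refl) eq with σ x u in p
  ... | just k  = cong just (agree p eq)
  ... | nothing = eq

  away : ∀ {x y l} → Identified x → σ x y ≡ just l → (σ u y <∣> σ v y) ≡ just l
  away {x} (inj₁ refl) eq rewrite eq = refl
  away {x} {y} (inj₂ refl) eq with σ u y in p
  ... | just k  = cong just (reverse-injective (agree (σ-flip G p) (σ-flip G eq)))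
  ... | nothing = eq

  fold-hom : IsHomomorphism G merged fold
  fold-hom x y l eq with fold x ≟ u | fold y ≟ u
  ... | yes p | yes q = contradiction eq (¬both-identified (fold≡u p) (fold≡u q))
  ... | yes p | no  q = away (fold≡u p) (trans (cong (σ x) (fold≢u q)) eq)
  ... | no  p | yes q = towards (fold≡u q) (trans (cong (λ z → σ z y) (fold≢u p)) eq)
  ... | no  p | no  q = subst₂ (λ a b → σ a b ≡ just l) (sym (fold≢u p)) (sym (fold≢u q)) eq

  fold-misses-v : u ≢ v → ∀ x → fold x ≢ v
  fold-misses-v u≢v x eq with x ≟ v
  ... | yes _   = u≢v eq
  ... | no  x≢v = x≢v eq

-- Both clique numbers in terms of pairwise joined families

deleteVertex : (G H : MixedGraph m n) (f : Fin (order G) → Fin (order H)) (v : Fin (order H)) →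
  IsHomomorphism G H f → (∀ x → f x ≢ v) →
  Σ (MixedGraph m n) λ H′ → order H′ < order H × ∃ (IsHomomorphism G H′)
deleteVertex G record { order = suc k ; σ = τ ; σ-loopless = τ-loopless ; σ-reverse = τ-reverse } f v hom misses =
  record
    { order      = k
    ; σ          = λ x y → τ (punchIn v x) (punchIn v y)
    ; σ-loopless = λ x → τ-loopless (punchIn v x)
    ; σ-reverse  = λ x y → τ-reverse (punchIn v x) (punchIn v y)
    } , ≤-refl , (λ x → punchOut (v≢f x)) , λ x y l eq →
      subst₂ (λ a b → τ a b ≡ just l)
        (sym (punchIn-punchOut (v≢f x))) (sym (punchIn-punchOut (v≢f y))) (hom x y l eq)
  where
  v≢f : ∀ x → v ≢ f x
  v≢f x = misses x ∘ sym

relative⇒joined : (G : MixedGraph m n) {R : Subset (order G)} → IsRelativeClique G R →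
                  ∀ {u v} → u ∈ R → v ∈ R → u ≢ v → Joined G u v
relative⇒joined G rc {u} {v} u∈R v∈R u≢v with joined? G u v
... | yes uv = uv
... | no ¬uv = contradiction (trans (fold-other u≢v) (sym fold-v))
                             (rc u v u∈R v∈R u≢v merged fold fold-hom)
  where open Merge G ¬uv

-- After merging u and v, the vertex v is outside the image; deleting it gives a target smaller than
-- A.
absolute⇒clique : (A : MixedGraph m n) → IsAbsoluteClique A → Clique A id
absolute⇒clique A (_ , minimal) u v u≢v with joined? A u v
... | yes uv = uv
... | no ¬uv with deleteVertex A merged fold v fold-hom (fold-misses-v u≢v)
  where open Merge A ¬uv
... | H , H<A , f , hom = contradiction H<A (≤⇒≯ (minimal (order H) (H , refl , f , hom)))

clique⇒absolute : (A : MixedGraph m n) → Clique A id → IsAbsoluteClique A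
clique⇒absolute A cl =
  (A , refl , id , λ _ _ _ eq → eq) ,
  λ { _ (H , refl , f , hom) →
      injective⇒≤ (clique-injective H {c = f} λ i j i≢j → joined-hom A H {f} hom (cl i j i≢j)) }

elements : ∀ {k} (S : Subset k) → Fin ∣ S ∣ → Fin k
elements (true  ∷ S) zero    = zero
elements (true  ∷ S) (suc i) = suc (elements S i)
elements (false ∷ S) i       = suc (elements S i)

elements-∈ : ∀ {k} (S : Subset k) i → elements S i ∈ S
elements-∈ (true  ∷ S) zero    = here
elements-∈ (true  ∷ S) (suc i) = there (elements-∈ S i)
elements-∈ (false ∷ S) i       = there (elements-∈ S i)

elements-injective : ∀ {k} (S : Subset k) → Injective _≡_ _≡_ (elements S)
elements-injective (true  ∷ S) {zero}  {zero}  eq = refl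
elements-injective (true  ∷ S) {suc i} {suc j} eq = cong suc (elements-injective S (suc-injective eq))
elements-injective (false ∷ S) eq = elements-injective S (suc-injective eq)

CliqueBound : (m n : ℕ) → ℕ → Set
CliqueBound m n b = (G : MixedGraph m n) → Subcubic (und G) →
  ∀ {k} (c : Fin k → Fin (order G)) → Clique G c → k ≤ b

noClique⇒bound : ∀ {b} →
  ((G : MixedGraph m n) → Subcubic (und G) → (c : Fin (suc b) → Fin (order G)) → ¬ Clique G c) →
  CliqueBound m n b
noClique⇒bound {b = b} none G sub {k} c cl with k ≤? b
... | yes k≤b = k≤b
... | no  k≰b = contradiction
  (λ i j i≢j → cl _ _ (i≢j ∘ inject≤-injective b<k b<k i j)) (none G sub (λ i → c (inject≤ i b<k)))
  where b<k = ≰⇒> k≰b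

-- Γ attains both maxima with its whole vertex set. For the upper bounds, the inclusion of an
-- absolute clique gives pairwise joined vertices of G, and a relative clique is pairwise joined
-- already, so one bound serves both.
cliqueNumbers : ∀ {b} → CliqueBound m n b →
  (Γ : MixedGraph m n) → order Γ ≡ b → Subcubic (und Γ) → Clique Γ id →
  ω-a[ m , n ] Subcubic b × ω-r[ m , n ] Subcubic b
cliqueNumbers bound Γ refl sub cl =
  ( ( Γ , sub
    , (Γ , (id , (λ eq → eq) , λ _ _ _ eq → eq) , clique⇒absolute Γ cl , refl)
    , λ { _ (A , (ι , ι-inj , _) , _ , refl) → injective⇒≤ ι-inj } )
  , λ { _ (G , sub′ , (A , (ι , _ , hom) , abs , refl) , _) →
        bound G sub′ ι λ i j i≢j → joined-hom A G {ι} hom (absolute⇒clique A abs i j i≢j) } ) ,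
  ( ( Γ , sub
    , (⊤ , (λ u v _ _ u≢v H f hom → joined-irrefl H (joined-hom Γ H {f} hom (cl u v u≢v))) , ∣⊤∣≡n _)
    , λ { _ (R , _ , refl) → ∣p∣≤n R } )
  , λ { _ (G , sub′ , (R , rc , refl) , _) →
        bound G sub′ (elements R) λ i j i≢j →
          relative⇒joined G rc (elements-∈ R i) (elements-∈ R j) (i≢j ∘ elements-injective R) } )

-- Pigeonhole principles

index-injective : ∀ {A : Set} {r k} {c : Fin r → A} → Injective _≡_ _≡_ c →
                  (xs : Vec A k) (cov : ∀ i → c i Vec.∈ xs) → Injective _≡_ _≡_ (index ∘ cov)
index-injective inj xs cov {i} {j} eq =
  inj (trans (lookup-index (cov i)) (trans (cong (lookup xs) eq) (sym (lookup-index (cov j)))))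

covered⇒≤ : ∀ {A : Set} {r k} {c : Fin r → A} → Injective _≡_ _≡_ c →
            (xs : Vec A k) → (∀ i → c i Vec.∈ xs) → r ≤ k
covered⇒≤ inj xs cov = injective⇒≤ (index-injective inj xs cov)

injective⇒surjective : ∀ {k} {g : Fin k → Fin k} → Injective _≡_ _≡_ g → ∀ j → ∃ λ i → g i ≡ j
injective⇒surjective {suc k} {g} inj j with any? (λ i → g i ≟ j)
... | yes hit = hit
... | no miss = contradiction (injective⇒≤ {f = λ i → punchOut (j≢g i)} (inj ∘ punchOut-injective (j≢g _) (j≢g _)))
                              (n≮n k)
  where
  j≢g : ∀ i → j ≢ g i
  j≢g i eq = miss (i , sym eq)

at : ∀ {A : Set} {k} (xs : Vec A k) i {v} → v ≡ lookup xs i → v Vec.∈ xs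
at xs i refl = ∈-lookup i xs

at3 : ∀ {A : Set} {k} (xs : Vec A k) i j l {v} →
      v ≡ lookup xs i ⊎ v ≡ lookup xs j ⊎ v ≡ lookup xs l → v Vec.∈ xs
at3 xs i j l (inj₁ eq)        = at xs i eq
at3 xs i j l (inj₂ (inj₁ eq)) = at xs j eq
at3 xs i j l (inj₂ (inj₂ eq)) = at xs l eq

-- The equality case of the pigeonhole principle: k distinct values covered by k entries use every
-- entry exactly once, so the entries are pairwise distinct too.
module Tight {A : Set} {k} {c : Fin k → A} (inj : Injective _≡_ _≡_ c)
             (xs : Vec A k) (cov : ∀ i → c i Vec.∈ xs) where

  g : Fin k → Fin k
  g i = index (cov i)

  g-injective : Injective _≡_ _≡_ g
  g-injective = index-injective inj xs cov

  lookup-hit : ∀ j → ∃ λ i → c i ≡ lookup xs j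
  lookup-hit j with i , refl ← injective⇒surjective g-injective j = i , lookup-index (cov i)

  lookup-injective : Injective _≡_ _≡_ (lookup xs)
  lookup-injective {x} {y} eq
    with i , refl ← injective⇒surjective g-injective x
       | j , refl ← injective⇒surjective g-injective y
    = cong g (inj (trans (lookup-index (cov i)) (trans eq (sym (lookup-index (cov j))))))

  distinct : ∀ x y {_ : True (¬? (x ≟ y))} → lookup xs x ≢ lookup xs y
  distinct x y {x≢y} eq = toWitness x≢y (lookup-injective eq)

-- The vector has exactly b entries, so d serves as padding.
listing : ∀ {A : Set} {k} (f : Fin k → A) (d : A) (S : Subset k) {b} → ∣ S ∣ ≤ b →
  Σ (Vec A b) λ xs → (∀ {v} → v ∈ S → f v Vec.∈ xs) × All (λ x → x ≡ d ⊎ ∃ λ v → v ∈ S × x ≡ f v) xs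
listing f d [] {b} _ = replicate b d , (λ ()) , pad b
  where
  pad : ∀ b → All (λ x → x ≡ d ⊎ ∃ λ v → v ∈ [] × x ≡ f v) (replicate b d)
  pad 0       = []
  pad (suc b) = inj₁ refl ∷ pad b
listing f d (true ∷ S) {suc b} (s≤s S≤b) with listing (f ∘ suc) d S S≤b
... | xs , cov , ok =
  f zero ∷ xs
  , (λ { here → here refl ; (there v∈S) → there (cov v∈S) })
  , inj₂ (zero , here , refl) ∷ All.map (λ { (inj₁ eq) → inj₁ eq ; (inj₂ (v , v∈S , eq)) → inj₂ (suc v , there v∈S , eq) }) ok
listing f d (false ∷ S) S≤b with listing (f ∘ suc) d S S≤b
... | xs , cov , ok =
  xs
  , (λ { (there v∈S) → cov v∈S })
  , All.map (λ { (inj₁ eq) → inj₁ eq ; (inj₂ (v , v∈S , eq)) → inj₂ (suc v , there v∈S , eq) }) ok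

-- Neighbourhoods in subcubic graphs

module Neighbourhoods (G : MixedGraph m n) where
  open MixedGraph G using (σ)
  open SimpleGraph (und G) using (degree; adjacent)

  private
    N : V G → Subset (order G)
    N u = tabulate (adjacent u)

  adj⇒∈ : ∀ {u v} → Adj G u v → v ∈ N u
  adj⇒∈ {u} {v} (l , eq) = lookup⇒[]= v _ (trans (lookup∘tabulate _ v) (cong is-just eq))

  ∈⇒adj : ∀ {u v} → v ∈ N u → Adj G u v
  ∈⇒adj {u} {v} v∈N with σ u v | trans (sym (lookup∘tabulate (adjacent u) v)) ([]=⇒lookup v∈N)
  ... | just l | _ = l , refl

  neighbours : ∀ u {b} → degree u ≤ b → Σ (Vec (V G) b) λ xs → ∀ {v} → Adj G u v → v Vec.∈ xs
  neighbours u deg with xs , cov , _ ← listing id u (N u) deg = xs , cov ∘ adj⇒∈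

  joined⇒distance≤2 : ∀ {u v} → Joined G u v → Adj G u v ⊎ ∃ λ t → Adj G u t × Adj G t v
  joined⇒distance≤2 (inj₁ uv) = inj₁ uv
  joined⇒distance≤2 (inj₂ (t , k , l , p , q , _)) = inj₂ (t , adj-sym G (k , p) , l , q)

  module _ (sub : Subcubic (und G)) where

    -- Names for the at most two neighbours of x other than u, padded with u.
    record Ports (x u : V G) : Set where
      field
        p q   : V G
        cover : Adj G x u → ∀ {v} → Adj G x v → v ≡ u ⊎ v ≡ p ⊎ v ≡ q
        p-adj : p ≢ u → Adj G x p
        q-adj : q ≢ u → Adj G x q

    ports : ∀ x u → Ports x u
    ports x u with adj? G x u
    ... | no ¬xu = record
      { p = u ; q = u
      ; cover = λ xu → contradiction xu ¬xu
      ; p-adj = λ u≢u → contradiction refl u≢u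
      ; q-adj = λ u≢u → contradiction refl u≢u }
    -- Removing u from the at most three neighbours of x leaves at most two.
    ... | yes xu with listing id u (N x - u) (s≤s⁻¹ (≤-trans (x∈p⇒∣p-x∣<∣p∣ (adj⇒∈ xu)) (sub x)))
    ... | p ∷ q ∷ [] , cov , p-ok ∷ q-ok ∷ [] = record
      { p = p ; q = q ; cover = λ _ → cover ; p-adj = port p-ok ; q-adj = port q-ok }
      where
      cover : ∀ {v} → Adj G x v → v ≡ u ⊎ v ≡ p ⊎ v ≡ q
      cover {v} xv with v ≟ u
      ... | yes v≡u = inj₁ v≡u
      ... | no  v≢u with cov (x∈p∧x≢y⇒x∈p-y (adj⇒∈ xv) v≢u)
      ... | here v≡p         = inj₂ (inj₁ v≡p)
      ... | there (here v≡q) = inj₂ (inj₂ v≡q)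
      port : ∀ {y} → (y ≡ u ⊎ ∃ λ v → v ∈ N x - u × y ≡ v) → y ≢ u → Adj G x y
      port (inj₁ y≡u) y≢u = contradiction y≡u y≢u
      port (inj₂ (_ , v∈ , refl)) _ = ∈⇒adj (p─q⊆p _ _ v∈)

-- Neighbours inside a family of vertices, and the induced graph

module Rows (G : MixedGraph m n) {k} (c : Fin k → V G) where
  open MixedGraph G using (σ)
  open Neighbourhoods G

  row : V G → Subset k
  row u = tabulate (λ j → is-just (σ u (c j)))

  ∈row⇒adj : ∀ {u j} → j ∈ row u → Adj G u (c j)
  ∈row⇒adj {u} {j} j∈ with σ u (c j) | trans (sym (lookup∘tabulate (λ j → is-just (σ u (c j))) j)) ([]=⇒lookup j∈)
  ... | just l | _ = l , refl

  adj⇒∈row : ∀ {u j} → Adj G u (c j) → j ∈ row u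
  adj⇒∈row {u} {j} (l , eq) =
    lookup⇒[]= j _ (trans (lookup∘tabulate (λ j → is-just (σ u (c j))) j) (cong is-just eq))

  row≤3 : Subcubic (und G) → Injective _≡_ _≡_ c → ∀ u → ∣ row u ∣ ≤ 3
  row≤3 sub inj u with neighbours u (sub u)
  ... | xs , nbr = covered⇒≤ {c = c ∘ elements (row u)} (elements-injective (row u) ∘ inj) xs
                             λ j → nbr (∈row⇒adj (elements-∈ (row u) j))

  -- A neighbour w outside the family would be a fourth neighbour of u.
  row≥3⇒closed : Subcubic (und G) → Injective _≡_ _≡_ c → ∀ {u} → 3 ≤ ∣ row u ∣ →
                 ∀ {w} → Adj G u w → ∃ λ j → c j ≡ w
  row≥3⇒closed sub inj {u} 3≤ {w} uw with any? (λ j → c j ≟ w)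
  ... | yes found = found
  ... | no missed = contradiction (≤-trans (s≤s 3≤) (covered⇒≤ {c = extended} extended-injective (proj₁ nbrs) covered))
                                  (n≮n 3)
    where
    nbrs = neighbours u (sub u)
    extended : Fin (suc ∣ row u ∣) → V G
    extended zero    = w
    extended (suc j) = c (elements (row u) j)
    extended-injective : Injective _≡_ _≡_ extended
    extended-injective {zero}  {zero}  _  = refl
    extended-injective {zero}  {suc j} eq = contradiction (_ , sym eq) missed
    extended-injective {suc j} {zero}  eq = contradiction (_ , eq) missed
    extended-injective {suc j} {suc l} eq = cong suc (elements-injective (row u) (inj eq))
    covered : ∀ j → extended j Vec.∈ proj₁ nbrs
    covered zero    = proj₂ nbrs uw
    covered (suc j) = proj₂ nbrs (∈row⇒adj (elements-∈ (row u) j))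

  induced : MixedGraph m n
  induced = record
    { order      = k
    ; σ          = λ i j → σ (c i) (c j)
    ; σ-loopless = λ i → MixedGraph.σ-loopless G (c i)
    ; σ-reverse  = λ i j → MixedGraph.σ-reverse G (c i) (c j)
    }

  induced-subcubic : Subcubic (und G) → Injective _≡_ _≡_ c → Subcubic (und induced)
  induced-subcubic sub inj i = row≤3 sub inj (c i)

  -- A special 2-path survives because its middle vertex, a neighbour of a member, is again a
  -- member.
  induced-clique : (∀ i {w} → Adj G (c i) w → ∃ λ j → c j ≡ w) → Clique G c → Clique induced id
  induced-clique closed cl i j i≢j with cl i j i≢j
  ... | inj₁ ij = inj₁ ij
  ... | inj₂ (w , k , l , p , q , k≢l) with closed i (adj-sym G (k , p))
  ... | w′ , refl = inj₂ (w′ , k , l , p , q , k≢l)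

-- All members lie within distance 2 of the first; degree 3 allows at most 1 + 3 + 3 · 2 = 10 such
-- vertices.
bound₁₀ : CliqueBound m n 10
bound₁₀ = noClique⇒bound none
  where
  none : (G : MixedGraph m n) → Subcubic (und G) → (c : Fin 11 → V G) → ¬ Clique G c
  none G sub c cl with Neighbourhoods.neighbours G (c 0F) (sub (c 0F))
  ... | x ∷ y ∷ z ∷ [] , nbr = n≮n 10 (covered⇒≤ (clique-injective G cl) ball reach)
    where
    open Neighbourhoods G
    u = c 0F
    module X = Ports (ports sub x u)
    module Y = Ports (ports sub y u)
    module Z = Ports (ports sub z u)
    ball : Vec (V G) 10
    ball = u ∷ x ∷ y ∷ z ∷ X.p ∷ X.q ∷ Y.p ∷ Y.q ∷ Z.p ∷ Z.q ∷ []
    within : ∀ {v} → Adj G u v ⊎ (∃ λ t → Adj G u t × Adj G t v) → v Vec.∈ ball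
    within (inj₁ uv) with nbr uv
    ... | here eq                 = at ball 1F eq
    ... | there (here eq)         = at ball 2F eq
    ... | there (there (here eq)) = at ball 3F eq
    within (inj₂ (t , ut , tv)) with nbr ut
    ... | here refl                 = at3 ball 0F 4F 5F (X.cover (adj-sym G ut) tv)
    ... | there (here refl)         = at3 ball 0F 6F 7F (Y.cover (adj-sym G ut) tv)
    ... | there (there (here refl)) = at3 ball 0F 8F 9F (Z.cover (adj-sym G ut) tv)
    reach : ∀ i → c i Vec.∈ ball
    reach zero    = here refl
    reach (suc i) = within (joined⇒distance≤2 (cl 0F (suc i) λ ()))

-- Sums over finite sets

⟦_⟧ : Bool → ℕ
⟦ true  ⟧ = 1
⟦ false ⟧ = 0

∣tabulate∣ : ∀ {k} (b : Fin k → Bool) → ∣ tabulate b ∣ ≡ ∑[ i < k ] ⟦ b i ⟧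
∣tabulate∣ {zero}  b = refl
∣tabulate∣ {suc k} b with b 0F
... | true  = cong suc (∣tabulate∣ (b ∘ suc))
... | false = ∣tabulate∣ (b ∘ suc)

∑-mono : ∀ {k} {f g : Fin k → ℕ} → (∀ i → f i ≤ g i) → sum f ≤ sum g
∑-mono {zero}  f≤g = z≤n
∑-mono {suc k} f≤g = +-mono-≤ (f≤g 0F) (∑-mono (f≤g ∘ suc))

term≤∑ : ∀ {k} (f : Fin k → ℕ) i → f i ≤ sum f
term≤∑ f zero    = m≤m+n _ _
term≤∑ f (suc i) = ≤-trans (term≤∑ (f ∘ suc) i) (m≤n+m _ _)

∑-positive : ∀ {k} (f : Fin k → ℕ) → 1 ≤ sum f → ∃ λ i → 1 ≤ f i
∑-positive {suc k} f 1≤∑ with f 0F in eq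
... | suc _ = 0F , subst (1 ≤_) (sym eq) (s≤s z≤n)
... | zero  with i , 1≤fi ← ∑-positive (f ∘ suc) 1≤∑ = suc i , 1≤fi

-- A strict inequality in one term could not be made up elsewhere. This turns tight counts into
-- exact local information.
∑-squeeze : ∀ {k} {f g : Fin k → ℕ} → (∀ i → f i ≤ g i) → sum g ≤ sum f → f ≗ g
∑-squeeze {suc k} {f} {g} f≤g ∑g≤∑f = pointwise
  where
  tail≤ : sum (f ∘ suc) ≤ sum (g ∘ suc)
  tail≤ = ∑-mono (f≤g ∘ suc)
  pointwise : f ≗ g
  pointwise zero    = ≤-antisym (f≤g 0F)
    (+-cancelʳ-≤ (sum (g ∘ suc)) _ _ (≤-trans ∑g≤∑f (+-monoʳ-≤ (f 0F) tail≤)))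
  pointwise (suc i) = ∑-squeeze (f≤g ∘ suc)
    (+-cancelˡ-≤ (g 0F) _ _ (≤-trans ∑g≤∑f (+-monoˡ-≤ _ (f≤g 0F)))) i

-- At most three edge types: no relative clique of order 9

-- Induction by removing the first row and column: by symmetry they have equal sums, and the
-- diagonal is zero. For an adjacency matrix this is the handshake lemma.
symmetric-sum-even : ∀ {k} (f : Fin k → Fin k → ℕ) → (∀ i → f i i ≡ 0) → (∀ i j → f j i ≡ f i j) →
                     2 ∣ ∑[ i < k ] ∑[ j < k ] f i j
symmetric-sum-even {zero}  f irr symm = divides 0 refl
symmetric-sum-even {suc k} f irr symm = subst (2 ∣_) (sym split) (∣m∣n⇒∣m+n (divides r double) ih)
  where
  r rest : ℕ
  r    = ∑[ j < k ] f 0F (suc j)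
  rest = ∑[ i < k ] ∑[ j < k ] f (suc i) (suc j)
  ih : 2 ∣ rest
  ih = symmetric-sum-even (λ i j → f (suc i) (suc j)) (irr ∘ suc) (λ i j → symm (suc i) (suc j))
  double : r + r ≡ r * 2
  double = lem r
    where lem : ∀ x → x + x ≡ x * 2
          lem = solve-∀
  split : ∑[ i < suc k ] ∑[ j < suc k ] f i j ≡ (r + r) + rest
  split = begin
    (f 0F 0F + r) + ∑[ i < k ] (f (suc i) 0F + ∑[ j < k ] f (suc i) (suc j))
      ≡⟨ cong₂ (λ a b → (a + r) + b) (irr 0F) (∑-distrib-+ (λ i → f (suc i) 0F) _) ⟩
    r + (∑[ i < k ] f (suc i) 0F + rest)
      ≡⟨ cong (λ a → r + (a + rest)) (sum-cong-≗ (λ i → symm 0F (suc i))) ⟩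
    r + (r + rest)
      ≡⟨ lem r rest ⟩
    (r + r) + rest ∎
    where open ≡-Reasoning
          lem : ∀ a b → a + (a + b) ≡ (a + a) + b
          lem = solve-∀

-- Junk value a when the two colours agree.
third : Fin 3 → Fin 3 → Fin 3
third 0F 1F = 2F
third 0F 2F = 1F
third 1F 0F = 2F
third 1F 2F = 0F
third 2F 0F = 1F
third 2F 1F = 0F
third a  _  = a

third-unique : ∀ a b s → a ≢ b → s ≢ a → s ≢ b → s ≡ third a b
third-unique a b s a≢b s≢a s≢b
  with from-yes (all? λ a → all? λ b → all? λ s → (a ≟ b) ⊎-dec ((s ≟ a) ⊎-dec ((s ≟ b) ⊎-dec (s ≟ third a b)))) a b s
... | inj₁ eq                      = contradiction eq a≢b
... | inj₂ (inj₁ eq)               = contradiction eq s≢a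
... | inj₂ (inj₂ (inj₁ eq))        = contradiction eq s≢b
... | inj₂ (inj₂ (inj₂ eq))        = eq

-- The variables are the colours of consecutive sides; at a vertex between two sides, `third` is the
-- colour left for the edge leaving the hexagon. The last three cases compare these edges at
-- antipodal vertices. All 729 colourings are checked.
hexagon-3-colours : ∀ e₀ e₁ e₂ e₃ e₄ e₅ →
  e₀ ≡ e₁ ⊎ e₁ ≡ e₂ ⊎ e₂ ≡ e₃ ⊎ e₃ ≡ e₄ ⊎ e₄ ≡ e₅ ⊎ e₅ ≡ e₀ ⊎
  third e₅ e₀ ≡ third e₂ e₃ ⊎ third e₀ e₁ ≡ third e₃ e₄ ⊎ third e₁ e₂ ≡ third e₄ e₅
hexagon-3-colours = from-yes (all? λ e₀ → all? λ e₁ → all? λ e₂ → all? λ e₃ → all? λ e₄ → all? λ e₅ →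
  (e₀ ≟ e₁) ⊎-dec ((e₁ ≟ e₂) ⊎-dec ((e₂ ≟ e₃) ⊎-dec ((e₃ ≟ e₄) ⊎-dec ((e₄ ≟ e₅) ⊎-dec ((e₅ ≟ e₀) ⊎-dec
  ((third e₅ e₀ ≟ third e₂ e₃) ⊎-dec ((third e₀ e₁ ≟ third e₃ e₄) ⊎-dec (third e₁ e₂ ≟ third e₄ e₅)))))))))

module NineClique (G : MixedGraph m n) (sub : Subcubic (und G))
                  (c : Fin 9 → V G) (cl : Clique G c) where
  open MixedGraph G using (σ)
  open Neighbourhoods G

  InR : V G → Set
  InR v = ∃ λ i → c i ≡ v

  inR? : ∀ v → Dec (InR v)
  inR? v = any? λ i → c i ≟ v

  joined : ∀ {u v} → InR u → InR v → u ≢ v → Joined G u v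
  joined (i , refl) (j , refl) u≢v = cl i j (u≢v ∘ cong c)

  symm : ∀ {u v} → Adj G u v → Adj G v u
  symm = adj-sym G

  module _ (closed : ∀ i {w} → Adj G (c i) w → InR w) where

    open Rows G c

    -- With two neighbours, only 1 + 2 + 2 · 2 = 7 vertices are within distance 2.
    row≰2 : ∀ i → ¬ ∣ row (c i) ∣ ≤ 2
    row≰2 i le with listing c (c i) (row (c i)) le
    ... | x ∷ y ∷ [] , cov , _ = from-no (9 ≤? 7) (covered⇒≤ (clique-injective G cl) ball reach)
      where
      u = c i
      module X = Ports (ports sub x u)
      module Y = Ports (ports sub y u)
      ball : Vec (V G) 7
      ball = u ∷ x ∷ y ∷ X.p ∷ X.q ∷ Y.p ∷ Y.q ∷ []
      nbr : ∀ {v} → Adj G u v → v Vec.∈ x ∷ y ∷ []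
      nbr uv with closed i uv
      ... | j , refl = cov (adj⇒∈row uv)
      within : ∀ {v} → Adj G u v ⊎ (∃ λ t → Adj G u t × Adj G t v) → v Vec.∈ ball
      within (inj₁ uv) with nbr uv
      ... | here eq         = at ball 1F eq
      ... | there (here eq) = at ball 2F eq
      within (inj₂ (t , ut , tv)) with nbr ut
      ... | here refl         = at3 ball 0F 3F 4F (X.cover (symm ut) tv)
      ... | there (here refl) = at3 ball 0F 5F 6F (Y.cover (symm ut) tv)
      reach : ∀ j → c j Vec.∈ ball
      reach j with c j ≟ u
      ... | yes eq  = here eq
      ... | no  neq = within (joined⇒distance≤2 (joined (i , refl) (j , refl) (neq ∘ sym)))

    row≡3 : ∀ i → ∣ row (c i) ∣ ≡ 3
    row≡3 i = ≤-antisym (row≤3 sub (clique-injective G cl) (c i)) (≰⇒> (row≰2 i))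

    -- The degrees inside R would add up to 9 · 3 = 27, an odd number.
    ¬closed : ⊥
    ¬closed = from-no (2 ∣? 27) (subst (2 ∣_) total
      (symmetric-sum-even (λ i j → ⟦ is-just (σ (c i) (c j)) ⟧)
        (λ i → cong ⟦_⟧ (SimpleGraph.loopless (und G) (c i)))
        (λ i j → cong ⟦_⟧ (SimpleGraph.symmetric (und G) (c i) (c j)))))
      where
      total : ∑[ i < 9 ] ∑[ j < 9 ] ⟦ is-just (σ (c i) (c j)) ⟧ ≡ 27
      total = sum-cong-≗ {x = λ i → ∑[ j < 9 ] ⟦ is-just (σ (c i) (c j)) ⟧} {y = λ _ → 3}
                         (λ i → trans (sym (∣tabulate∣ (λ j → is-just (σ (c i) (c j))))) (row≡3 i))

  module _ {w : V G} (w∉R : ¬ InR w) where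

    -- u is a neighbour of w, and x, y are its other two neighbours; the fields describe
    -- the situation from x, and Hub² below adds the mirror image.
    record Hub (u x y : V G) : Set where
      field
        wu       : Adj G w u
        ux       : Adj G u x
        x∈R      : InR x
        x≢y      : x ≢ y
        x≁y      : ¬ Adj G x y
        x≁w      : ¬ Adj G w x
        x≁hub    : ∀ {t} → Adj G w t → t ≢ u → ¬ Adj G x t
        cover    : ∀ {t} → InR t → t ≢ u → t ≢ x → t ≢ y → ¬ Adj G w t → Adj G x t ⊎ Adj G y t
        disjoint : ∀ {t} → Adj G x t → t ≢ u → ¬ Adj G y t
        differ   : ∀ {t} → Adj G x t → t ≢ u → Differ (σ x u) (σ x t)

    -- Within distance 2 of u there are, besides u, at most w, x, y and two further neighbours of
    -- each. As w is not in R, nine places remain for nine members, so by `Tight` these places are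
    -- distinct members of R.
    module OutsideNeighbour {u : V G} (u∈R : InR u) (uw : Adj G u w) (U : Ports sub u w) where
      module U = Ports U
      module W = Ports (ports sub w u)
      x = U.p
      y = U.q
      module X = Ports (ports sub x u)
      module Y = Ports (ports sub y u)
      ball : Vec (V G) 9
      ball = u ∷ x ∷ y ∷ W.p ∷ W.q ∷ X.p ∷ X.q ∷ Y.p ∷ Y.q ∷ []
      within : ∀ {v} → v ≢ w → Adj G u v ⊎ (∃ λ t → Adj G u t × Adj G t v) → v Vec.∈ ball
      within v≢w (inj₁ uv) with U.cover uw uv
      ... | inj₁ eq        = contradiction eq v≢w
      ... | inj₂ (inj₁ eq) = at ball 1F eq
      ... | inj₂ (inj₂ eq) = at ball 2F eq
      within v≢w (inj₂ (t , ut , tv)) with U.cover uw ut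
      ... | inj₁ refl        = at3 ball 0F 3F 4F (W.cover (symm ut) tv)
      ... | inj₂ (inj₁ refl) = at3 ball 0F 5F 6F (X.cover (symm ut) tv)
      ... | inj₂ (inj₂ refl) = at3 ball 0F 7F 8F (Y.cover (symm ut) tv)
      reach : ∀ {v} → InR v → v Vec.∈ ball
      reach {v} v∈R with v ≟ u
      ... | yes eq  = here eq
      ... | no  neq = within (λ { refl → w∉R v∈R }) (joined⇒distance≤2 (joined u∈R v∈R (neq ∘ sym)))
      module T = Tight (clique-injective G cl) ball (λ i → reach (i , refl))
      outside : ∀ i → lookup ball i ≢ w
      outside i eq = w∉R (subst InR eq (T.lookup-hit i))
      x≢w : x ≢ w
      x≢w = outside 1F
      xu : Adj G x u
      xu = symm (U.p-adj x≢w)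
      yu : Adj G y u
      yu = symm (U.q-adj (outside 2F))
      clash : ∀ {t} → t ≡ u ⊎ t ≡ W.p ⊎ t ≡ W.q → t ≡ X.p ⊎ t ≡ X.q → ⊥
      clash (inj₁ refl)        (inj₁ eq) = T.distinct 0F 5F eq
      clash (inj₁ refl)        (inj₂ eq) = T.distinct 0F 6F eq
      clash (inj₂ (inj₁ refl)) (inj₁ eq) = T.distinct 3F 5F eq
      clash (inj₂ (inj₁ refl)) (inj₂ eq) = T.distinct 3F 6F eq
      clash (inj₂ (inj₂ refl)) (inj₁ eq) = T.distinct 4F 5F eq
      clash (inj₂ (inj₂ refl)) (inj₂ eq) = T.distinct 4F 6F eq
      disjoint : ∀ {t} → t ≡ u ⊎ t ≡ X.p ⊎ t ≡ X.q → t ≡ u ⊎ t ≡ Y.p ⊎ t ≡ Y.q → t ≢ u → ⊥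
      disjoint (inj₁ eq) _ t≢u = t≢u eq
      disjoint (inj₂ _) (inj₁ eq) t≢u = t≢u eq
      disjoint (inj₂ (inj₁ refl)) (inj₂ (inj₁ eq)) _ = T.distinct 5F 7F eq
      disjoint (inj₂ (inj₁ refl)) (inj₂ (inj₂ eq)) _ = T.distinct 5F 8F eq
      disjoint (inj₂ (inj₂ refl)) (inj₂ (inj₁ eq)) _ = T.distinct 6F 7F eq
      disjoint (inj₂ (inj₂ refl)) (inj₂ (inj₂ eq)) _ = T.distinct 6F 8F eq
      cover : ∀ {t} → InR t → t ≢ u → t ≢ x → t ≢ y → ¬ Adj G w t → Adj G x t ⊎ Adj G y t
      cover {t} t∈R t≢u t≢x t≢y t≁w with joined⇒distance≤2 (joined u∈R t∈R (t≢u ∘ sym))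
      ... | inj₁ ut = contradiction (U.cover uw ut) [ (λ { refl → w∉R t∈R }) , [ t≢x , t≢y ]′ ]′
      ... | inj₂ (s , us , st) with U.cover uw us
      ... | inj₁ refl        = contradiction st t≁w
      ... | inj₂ (inj₁ refl) = inj₁ st
      ... | inj₂ (inj₂ refl) = inj₂ st
      -- As u and t are not adjacent, a special 2-path joins them. Its middle vertex is a neighbour
      -- of u; w and y are not adjacent to t, which leaves x.
      differ : ∀ {t} → Adj G x t → t ≢ u → t ≡ u ⊎ t ≡ X.p ⊎ t ≡ X.q → Differ (σ x u) (σ x t)
      differ xt t≢u (inj₁ eq) = contradiction eq t≢u
      differ {t} xt t≢u (inj₂ t≡) with joined u∈R (∈R t≡) (t≢u ∘ sym)
        where
        ∈R : ∀ {t} → t ≡ X.p ⊎ t ≡ X.q → InR t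
        ∈R (inj₁ refl) = T.lookup-hit 5F
        ∈R (inj₂ refl) = T.lookup-hit 6F
      ... | inj₁ ut = contradiction (U.cover uw ut) (away t≡)
        where
        away : ∀ {t} → t ≡ X.p ⊎ t ≡ X.q → ¬ (t ≡ w ⊎ t ≡ x ⊎ t ≡ y)
        away (inj₁ refl) = [ outside 5F , [ T.distinct 5F 1F , T.distinct 5F 2F ]′ ]′
        away (inj₂ refl) = [ outside 6F , [ T.distinct 6F 1F , T.distinct 6F 2F ]′ ]′
      ... | inj₂ (s , k , l , p , q , k≢l) with U.cover uw (symm (k , p))
      ... | inj₁ refl        = contradiction t≡ (clash (W.cover (k , p) (l , q)))
      ... | inj₂ (inj₁ refl) = k , l , p , q , k≢l
      ... | inj₂ (inj₂ refl) = contradiction t≢u (disjoint (inj₂ t≡) (Y.cover yu (l , q)))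

      hub : Hub u x y
      hub = record
        { wu       = symm uw
        ; ux       = U.p-adj x≢w
        ; x∈R      = T.lookup-hit 1F
        ; x≢y      = T.distinct 1F 2F
        ; x≁y      = λ xy → [ T.distinct 2F 0F , [ T.distinct 2F 5F , T.distinct 2F 6F ]′ ]′ (X.cover xu xy)
        ; x≁w      = λ wx → [ T.distinct 1F 0F , [ T.distinct 1F 3F , T.distinct 1F 4F ]′ ]′ (W.cover (symm uw) wx)
        ; x≁hub    = λ wt t≢u xt → [ t≢u , clash (W.cover (symm uw) wt) ]′ (X.cover xu xt)
        ; cover    = cover
        ; disjoint = λ xt t≢u yt → disjoint (X.cover xu xt) (Y.cover yu yt) t≢u
        ; differ   = λ xt t≢u → differ xt t≢u (X.cover xu xt)
        }

      otherNeighbours : ∃₂ λ p q → (InR p × Adj G w p) × (InR q × Adj G w q) × u ≢ p × u ≢ q × p ≢ q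
      otherNeighbours = W.p , W.q
        , (T.lookup-hit 3F , W.p-adj (T.distinct 3F 0F)) , (T.lookup-hit 4F , W.q-adj (T.distinct 4F 0F))
        , T.distinct 0F 3F , T.distinct 0F 4F , T.distinct 3F 4F

    -- Exchanging the ports of u exchanges x and y in `OutsideNeighbour`, which gives the second
    -- half of `Hub²`.
    swapPorts : ∀ {x u} → Ports sub x u → Ports sub x u
    swapPorts P = record
      { p = q ; q = p
      ; cover = λ xu xv → [ inj₁ , [ inj₂ ∘ inj₂ , inj₂ ∘ inj₁ ]′ ]′ (cover xu xv)
      ; p-adj = q-adj ; q-adj = p-adj }
      where open Ports P

    Hub² : V G → V G → V G → Set
    Hub² u x y = Hub u x y × Hub u y x

    swapHub : ∀ {u x y} → Hub² u x y → Hub² u y x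
    swapHub (h , h′) = h′ , h

    hub² : ∀ {u} → InR u → Adj G w u → ∃₂ (Hub² u)
    hub² {u} u∈R wu = _ , _
      , OutsideNeighbour.hub u∈R (symm wu) (ports sub u w)
      , OutsideNeighbour.hub u∈R (symm wu) (swapPorts (ports sub u w))

    module _ {u₀ u₁ x₀ y₀ x₁ y₁} (u₀≢u₁ : u₀ ≢ u₁) (H₀ : Hub u₀ x₀ y₀) (H₁ : Hub u₁ x₁ y₁) where
      private
        module H₀ = Hub H₀
        module H₁ = Hub H₁

      x≢hub : x₁ ≢ u₀
      x≢hub refl = H₁.x≁w H₀.wu

      x≢x : x₁ ≢ x₀
      x≢x refl = H₀.x≁hub H₁.wu (u₀≢u₁ ∘ sym) (symm H₁.ux)

    across : ∀ {u₀ u₁ x₀ y₀ x₁ y₁} → u₀ ≢ u₁ → Hub² u₀ x₀ y₀ → Hub u₁ x₁ y₁ → Adj G x₀ x₁ ⊎ Adj G y₀ x₁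
    across u₀≢u₁ (h₀ , h₀′) h₁ =
      Hub.cover h₀ (Hub.x∈R h₁) (x≢hub u₀≢u₁ h₀ h₁) (x≢x u₀≢u₁ h₀ h₁) (x≢x u₀≢u₁ h₀′ h₁) (Hub.x≁w h₁)

    -- If x₁ and y₁ were adjacent to the same one of x₀ and y₀, they would share a neighbour besides
    -- u₁. So the edges form a matching, and swapping x₁ with y₁ if necessary makes it straight.
    align : ∀ {u₀ u₁ x₀ y₀ x₁ y₁} → u₀ ≢ u₁ → Hub² u₀ x₀ y₀ → Hub² u₁ x₁ y₁ →
            ∃₂ λ x y → Hub² u₁ x y × Adj G x₀ x × Adj G y₀ y
    align u₀≢u₁ H₀@(h₀ , h₀′) H₁@(h₁ , h₁′) with across u₀≢u₁ H₀ h₁ | across u₀≢u₁ H₀ h₁′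
    ... | inj₁ p | inj₂ q = _ , _ , H₁ , p , q
    ... | inj₂ p | inj₁ q = _ , _ , swapHub H₁ , q , p
    ... | inj₁ p | inj₁ q = contradiction (symm q) (Hub.disjoint h₁ (symm p) (x≢hub (u₀≢u₁ ∘ sym) h₁ h₀))
    ... | inj₂ p | inj₂ q = contradiction (symm q) (Hub.disjoint h₁ (symm p) (x≢hub (u₀≢u₁ ∘ sym) h₁ h₀′))

    -- The two ports of t relative to a are filled by b and d.
    only : ∀ {t a b d v} → Adj G t a → Adj G t b → Adj G t d → b ≢ a → d ≢ a → b ≢ d →
           Adj G t v → v ≡ a ⊎ v ≡ b ⊎ v ≡ d
    only {t} {a} ta tb td b≢a d≢a b≢d tv with P.cover ta tb | P.cover ta td | P.cover ta tv
      where module P = Ports (ports sub t a)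
    ... | inj₁ b≡a         | _                | _                = contradiction b≡a b≢a
    ... | inj₂ _           | inj₁ d≡a         | _                = contradiction d≡a d≢a
    ... | inj₂ _           | inj₂ _           | inj₁ v≡a         = inj₁ v≡a
    ... | inj₂ (inj₁ refl) | inj₂ (inj₁ refl) | inj₂ _           = contradiction refl b≢d
    ... | inj₂ (inj₂ refl) | inj₂ (inj₂ refl) | inj₂ _           = contradiction refl b≢d
    ... | inj₂ (inj₁ refl) | inj₂ (inj₂ refl) | inj₂ v≡          = inj₂ v≡
    ... | inj₂ (inj₂ refl) | inj₂ (inj₁ refl) | inj₂ (inj₁ v≡d)  = inj₂ (inj₂ v≡d)
    ... | inj₂ (inj₂ refl) | inj₂ (inj₁ refl) | inj₂ (inj₂ v≡b)  = inj₂ (inj₁ v≡b)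

    -- The situation around one vertex x with hub u: its other neighbours a and b belong to the hubs
    -- p and q, and a′ and b′ are their partners there.
    module Corner {u p q x y a a′ b b′} (u≢p : u ≢ p) (u≢q : u ≢ q) (p≢q : p ≢ q)
                  (X : Hub² u x y) (A : Hub² p a a′) (B : Hub² q b b′)
                  (xa : Adj G x a) (xb : Adj G x b) where
      private
        X₁ = proj₁ X
        X₂ = proj₂ X
        A₁ = proj₁ A
        A₂ = proj₂ A
        B₁ = proj₁ B
        B₂ = proj₂ B
        module X = Hub X₁
        module A = Hub A₁
        module B = Hub B₁

      around : ∀ {t} → Adj G x t → t ≡ u ⊎ t ≡ a ⊎ t ≡ b
      around = only (symm X.ux) xa xb (x≢hub u≢p X₁ A₁) (x≢hub u≢q X₁ B₁) (x≢x (p≢q ∘ sym) B₁ A₁)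

      -- Of the neighbours u, a, b of x, only the hub u is adjacent to y, so it is the middle of the
      -- special 2-path.
      spokes-differ : Differ (σ u x) (σ u y)
      spokes-differ with joined X.x∈R (Hub.x∈R X₂) X.x≢y
      ... | inj₁ xy = contradiction xy X.x≁y
      ... | inj₂ (t , k , l , tx , ty , k≢l) with around (symm (k , tx))
      ... | inj₁ refl        = k , l , tx , ty , k≢l
      ... | inj₂ (inj₁ refl) = contradiction (symm (l , ty)) (X.disjoint xa (x≢hub u≢p X₁ A₁))
      ... | inj₂ (inj₂ refl) = contradiction (symm (l , ty)) (X.disjoint xb (x≢hub u≢q X₁ B₁))

      -- Since a is adjacent to b′, it is not adjacent to b. The neighbours of a are p, x, b′, and
      -- of these only x is adjacent to b.
      sides-differ : Adj G a b′ → Differ (σ x a) (σ x b)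
      sides-differ ab′ with joined A.x∈R B.x∈R (x≢x (p≢q ∘ sym) B₁ A₁)
      ... | inj₁ ab = contradiction (symm ab) (Hub.disjoint B₂ (symm ab′) (x≢hub (p≢q ∘ sym) B₁ A₁))
      ... | inj₂ (t , k , l , ta , tb , k≢l)
        with only (symm A.ux) (symm xa) ab′ (x≢hub (u≢p ∘ sym) A₁ X₁) (x≢hub p≢q A₁ B₂)
                  (x≢x (u≢q ∘ sym) B₂ X₁) (symm (k , ta))
      ... | inj₁ refl        = contradiction (symm (l , tb)) (B.x≁hub A.wu p≢q)
      ... | inj₂ (inj₁ refl) = k , l , ta , tb , k≢l
      ... | inj₂ (inj₂ refl) = contradiction (symm (l , tb)) B.x≁y

      -- Otherwise a′ is out of reach of x: it is adjacent neither to x nor to u, a or b. In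
      -- particular b cannot be adjacent to both a and a′.
      no-triangle : ¬ Adj G a b
      no-triangle ab with joined⇒distance≤2 (joined X.x∈R (Hub.x∈R A₂) (x≢x (u≢p ∘ sym) A₂ X₁))
      ... | inj₁ xa′ = A.disjoint (symm xa) (x≢hub (u≢p ∘ sym) A₁ X₁) (symm xa′)
      ... | inj₂ (t , xt , ta′) with around xt
      ... | inj₁ refl        = Hub.x≁hub A₂ X.wu u≢p (symm ta′)
      ... | inj₂ (inj₁ refl) = A.x≁y ta′
      ... | inj₂ (inj₂ refl) = A.disjoint ab (x≢hub p≢q A₁ B₁) (symm ta′)

    -- The cyclic order is x₀ x₁ x₂ y₀ y₁ y₂, with sides `e₀` to `e₅`; antipodal vertices share a
    -- hub.
    record Hexagon (u₀ u₁ u₂ x₀ x₁ x₂ y₀ y₁ y₂ : V G) : Set where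
      constructor hexagon
      field
        0≢1 : u₀ ≢ u₁
        1≢2 : u₁ ≢ u₂
        2≢0 : u₂ ≢ u₀
        H₀  : Hub² u₀ x₀ y₀
        H₁  : Hub² u₁ x₁ y₁
        H₂  : Hub² u₂ x₂ y₂
        e₀  : Adj G x₀ x₁
        e₁  : Adj G x₁ x₂
        e₂  : Adj G x₂ y₀
        e₃  : Adj G y₀ y₁
        e₄  : Adj G y₁ y₂
        e₅  : Adj G y₂ x₀

    rotate : ∀ {u₀ u₁ u₂ x₀ x₁ x₂ y₀ y₁ y₂} →
             Hexagon u₀ u₁ u₂ x₀ x₁ x₂ y₀ y₁ y₂ → Hexagon u₁ u₂ u₀ x₁ x₂ y₀ y₁ y₂ x₀
    rotate (hexagon 0≢1 1≢2 2≢0 H₀ H₁ H₂ e₀ e₁ e₂ e₃ e₄ e₅) =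
      hexagon 1≢2 2≢0 0≢1 H₁ H₂ (swapHub H₀) e₁ e₂ e₃ e₄ e₅ e₀

    -- `align` straightens the matchings from u₀ to u₁ and from u₁ to u₂. The one between u₂ and u₀
    -- must then cross, since otherwise a triangle closes up, against `no-triangle`.
    findHexagon : ∀ {u₀ u₁ u₂} → u₀ ≢ u₁ → u₁ ≢ u₂ → u₂ ≢ u₀ →
      ∃₂ (Hub² u₀) → ∃₂ (Hub² u₁) → ∃₂ (Hub² u₂) →
      ∃₂ λ x₀ x₁ → ∃₂ λ x₂ y₀ → ∃₂ (Hexagon u₀ u₁ u₂ x₀ x₁ x₂ y₀)
    findHexagon 0≢1 1≢2 2≢0 (_ , _ , H₀) (_ , _ , H₁′) (_ , _ , H₂′)
      with _ , _ , H₁ , e₀ , e₃ ← align 0≢1 H₀ H₁′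
      with _ , _ , H₂ , e₁ , e₄ ← align 1≢2 H₁ H₂′
      with across (2≢0 ∘ sym) H₀ (proj₁ H₂) | across (2≢0 ∘ sym) H₀ (proj₂ H₂)
    ... | inj₁ x₀x₂ | _ = contradiction e₁ (Corner.no-triangle 0≢1 (2≢0 ∘ sym) 1≢2 H₀ H₁ H₂ e₀ x₀x₂)
    ... | inj₂ _ | inj₂ y₀y₂ =
      contradiction e₄ (Corner.no-triangle 0≢1 (2≢0 ∘ sym) 1≢2 (swapHub H₀) (swapHub H₁) (swapHub H₂) e₃ y₀y₂)
    ... | inj₂ y₀x₂ | inj₁ x₀y₂ =
      _ , _ , _ , _ , _ , _ , hexagon 0≢1 1≢2 2≢0 H₀ H₁ H₂ e₀ e₁ (symm y₀x₂) e₃ e₄ (symm x₀y₂)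

    module _ (κ : V G → V G → Fin 3) (κ-sym : ∀ u v → κ u v ≡ κ v u)
             (κ-differ : ∀ {x a b} → Differ (σ x a) (σ x b) → κ x a ≢ κ x b) where

      module _ {u₀ u₁ u₂ x₀ x₁ x₂ y₀ y₁ y₂} (hex : Hexagon u₀ u₁ u₂ x₀ x₁ x₂ y₀ y₁ y₂) where
        open Hexagon hex
        private
          -- The corner at x₀ lies between x₁ and y₂, so the pair at u₂ is swapped to put y₂ first.
          module C = Corner 0≢1 (2≢0 ∘ sym) 1≢2 H₀ H₁ (swapHub H₂) e₀ (symm e₅)
          x₁≢u₀ = x≢hub 0≢1 (proj₁ H₀) (proj₁ H₁)
          y₂≢u₀ = x≢hub (2≢0 ∘ sym) (proj₁ H₀) (proj₂ H₂)

        sides : κ y₂ x₀ ≢ κ x₀ x₁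
        sides eq = κ-differ (C.sides-differ e₁) (trans (sym eq) (κ-sym y₂ x₀))

        -- The spoke and the two sides at x₀ have three different colours, so the sides determine
        -- the spoke.
        spoke : κ u₀ x₀ ≡ third (κ y₂ x₀) (κ x₀ x₁)
        spoke = third-unique _ _ _ sides
          (λ eq → κ-differ (Hub.differ (proj₁ H₀) (symm e₅) y₂≢u₀) (trans (κ-sym x₀ u₀) (trans eq (κ-sym y₂ x₀))))
          (λ eq → κ-differ (Hub.differ (proj₁ H₀) e₀ x₁≢u₀) (trans (κ-sym x₀ u₀) eq))

        opposite : κ u₀ x₀ ≢ κ u₀ y₀
        opposite = κ-differ C.spokes-differ

      ¬hexagon : ∀ {u₀ u₁ u₂ x₀ x₁ x₂ y₀ y₁ y₂} → ¬ Hexagon u₀ u₁ u₂ x₀ x₁ x₂ y₀ y₁ y₂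
      ¬hexagon {x₀ = x₀} {x₁} {x₂} {y₀} {y₁} {y₂} h₀ =
        -- `h₁` to `h₅` start the hexagon at each further vertex. The first six cases are equal
        -- consecutive sides, the last three equal spokes at antipodal vertices.
        [ sides h₁ , [ sides h₂ , [ sides h₃ , [ sides h₄ , [ sides h₅ , [ sides h₀ , [ clash h₀ , [ clash h₁ , clash h₂ ]′ ]′ ]′ ]′ ]′ ]′ ]′ ]′
        (hexagon-3-colours (κ x₀ x₁) (κ x₁ x₂) (κ x₂ y₀) (κ y₀ y₁) (κ y₁ y₂) (κ y₂ x₀))
        where
        h₁ = rotate h₀
        h₂ = rotate h₁
        h₃ = rotate h₂
        h₄ = rotate h₃
        h₅ = rotate h₄
        clash : ∀ {u₀ u₁ u₂ x₀ x₁ x₂ y₀ y₁ y₂} → Hexagon u₀ u₁ u₂ x₀ x₁ x₂ y₀ y₁ y₂ →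
                ¬ third (κ y₂ x₀) (κ x₀ x₁) ≡ third (κ x₂ y₀) (κ y₀ y₁)
        -- Three rotations move the antipode y₀ to the front.
        clash h eq = opposite h (trans (spoke h) (trans eq (sym (spoke (rotate (rotate (rotate h)))))))

      ¬outside : ∀ {u} → InR u → ¬ Adj G u w
      ¬outside {u} u∈R uw = conclude (OutsideNeighbour.otherNeighbours u∈R uw (ports sub u w))
        where
        conclude : ¬ (∃₂ λ p q → (InR p × Adj G w p) × (InR q × Adj G w q) × u ≢ p × u ≢ q × p ≢ q)
        conclude (p , q , (p∈R , wp) , (q∈R , wq) , u≢p , u≢q , p≢q) =
          let _ , _ , _ , _ , _ , _ , hex =
                findHexagon u≢p p≢q (u≢q ∘ sym) (hub² u∈R (symm uw)) (hub² p∈R wp) (hub² q∈R wq)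
          in ¬hexagon hex

-- Without arcs a label reads the same in both directions and so is an edge colour. By `¬outside` no
-- member has a neighbour outside R, and `¬closed` refutes that.
bound₈ : ∀ {n} → n ≤ 3 → CliqueBound 0 n 8
bound₈ {n} n≤3 = noClique⇒bound none
  where
  colour : Maybe (Label 0 n) → Fin 3
  colour (just (edge k)) = inject≤ k n≤3
  -- Default for non-adjacent pairs; `colour-differ` compares only labels that are present.
  colour nothing         = 0F

  colour-reverse : ∀ l → colour (Maybe.map reverse l) ≡ colour l
  colour-reverse (just (edge _)) = refl
  colour-reverse nothing         = refl

  colour-differ : ∀ {k l} → Differ k l → colour k ≢ colour l
  colour-differ (edge j , edge k , refl , refl , j≢k) eq = j≢k (cong edge (inject≤-injective n≤3 n≤3 j k eq))

  none : (G : MixedGraph 0 n) → Subcubic (und G) → (c : Fin 9 → V G) → ¬ Clique G c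
  none G sub c cl = ¬closed λ i {w} iw → decidable-stable (inR? w) λ w∉R →
    ¬outside w∉R (λ u v → colour (σ u v))
      (λ u v → sym (trans (cong colour (σ-reverse u v)) (colour-reverse (σ u v))))
      colour-differ (i , refl) iw
    where
    open MixedGraph G using (σ; σ-reverse)
    open NineClique G sub c cl

-- Oriented graphs: no relative clique of order 8

module Arcs (G : MixedGraph 1 0) where
  open MixedGraph G using (σ; σ-loopless; σ-reverse)

  forward : Maybe (Label 1 0) → Bool
  forward (just (arc⁺ _)) = true
  forward _               = false

  _⇒_ : V G → V G → Bool
  u ⇒ v = forward (σ u v)

  O : V G → V G → ℕ
  O u v = ⟦ u ⇒ v ⟧

  adjacency : ∀ u v → ⟦ is-just (σ u v) ⟧ ≡ O u v + O v u
  adjacency u v rewrite σ-reverse u v with σ u v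
  ... | nothing       = refl
  ... | just (arc⁺ _) = refl
  ... | just (arc⁻ _) = refl

  arc-asym : ∀ {u v} → u ⇒ v ≡ true → v ⇒ u ≡ true → ⊥
  arc-asym {u} {v} p q rewrite σ-reverse u v with σ u v
  arc-asym p () | just (arc⁺ _)
  arc-asym () q | just (arc⁻ _)
  arc-asym () q | nothing

  Path : V G → V G → Set
  Path u v = ∃ λ w → u ⇒ w ≡ true × w ⇒ v ≡ true

  into : ∀ {u v k} → σ u v ≡ just (arc⁺ k) → u ⇒ v ≡ true
  into eq = cong forward eq

  outof : ∀ {u v k} → σ u v ≡ just (arc⁻ k) → v ⇒ u ≡ true
  outof {u} {v} eq = cong forward (σ-flip G {u} {v} eq)

  -- With a single arc type, the labels at a middle vertex differ exactly when one arc enters it and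
  -- the other leaves.
  joined⇒ : ∀ {u v} → Joined G u v → (u ⇒ v ≡ true ⊎ v ⇒ u ≡ true) ⊎ (Path u v ⊎ Path v u)
  joined⇒ (inj₁ (arc⁺ _ , eq)) = inj₁ (inj₁ (into eq))
  joined⇒ (inj₁ (arc⁻ _ , eq)) = inj₁ (inj₂ (outof eq))
  joined⇒ (inj₂ (w , arc⁺ 0F , arc⁺ 0F , p , q , k≢l)) = contradiction refl k≢l
  joined⇒ (inj₂ (w , arc⁺ _  , arc⁻ _  , p , q , _))   = inj₂ (inj₂ (w , outof q , into p))
  joined⇒ (inj₂ (w , arc⁻ _  , arc⁺ _  , p , q , _))   = inj₂ (inj₁ (w , outof p , into q))
  joined⇒ (inj₂ (w , arc⁻ 0F , arc⁻ 0F , p , q , k≢l)) = contradiction refl k≢l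

module EightClique (G : MixedGraph 1 0) (sub : Subcubic (und G))
                   (c : Fin 8 → V G) (cl : Clique G c) where
  open MixedGraph G using (σ)
  open Arcs G
  open Rows G c

  N = order G

  -- `T` counts arcs and directed 2-paths in both directions. Middle vertices range over all of G,
  -- as they may lie outside the clique, whereas `inn` and `out` count members only.
  a paths T : Fin 8 → Fin 8 → ℕ
  a i j     = O (c i) (c j) + O (c j) (c i)
  paths i j = ∑[ w < N ] (O (c i) w * O w (c j) + O (c j) w * O w (c i))
  T i j     = a i j + paths i j

  inn out : V G → ℕ
  inn w = ∑[ j < 8 ] O (c j) w
  out w = ∑[ j < 8 ] O w (c j)

  apart : Fin 8 → Fin 8 → ℕ
  apart i j = ⟦ not (does (i ≟ j)) ⟧

  apart≤T : ∀ i j → apart i j ≤ T i j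
  apart≤T i j with i ≟ j
  ... | yes _  = z≤n
  ... | no i≢j with joined⇒ (cl i j i≢j)
  ... | inj₁ (inj₁ p) rewrite p = s≤s z≤n
  ... | inj₁ (inj₂ p) rewrite p = ≤-trans (m≤n+m 1 (O (c i) (c j))) (m≤m+n _ (paths i j))
  ... | inj₂ (inj₁ (w , p , q)) = ≤-trans (≤-trans step (term≤∑ _ w)) (m≤n+m (paths i j) (a i j))
    where
    step : 1 ≤ O (c i) w * O w (c j) + O (c j) w * O w (c i)
    step rewrite p | q = s≤s z≤n
  ... | inj₂ (inj₂ (w , p , q)) = ≤-trans (≤-trans step (term≤∑ _ w)) (m≤n+m (paths i j) (a i j))
    where
    step : 1 ≤ O (c i) w * O w (c j) + O (c j) w * O w (c i)
    step rewrite p | q = m≤n+m 1 (O (c i) w * O w (c j))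

  row-size : ∀ w → out w + inn w ≡ ∣ row w ∣
  row-size w = sym (trans (∣tabulate∣ (λ j → is-just (σ w (c j))))
    (trans (sum-cong-≗ λ j → adjacency w (c j)) (∑-distrib-+ (λ j → O w (c j)) (λ j → O (c j) w))))

  out+inn≤3 : ∀ w → out w + inn w ≤ 3
  out+inn≤3 w = subst (_≤ 3) (sym (row-size w)) (row≤3 sub (clique-injective G cl) w)

  ∑a-row : ∀ i → ∑[ j < 8 ] a i j ≡ out (c i) + inn (c i)
  ∑a-row i = ∑-distrib-+ (λ j → O (c i) (c j)) (λ j → O (c j) (c i))

  -- Every pair is counted, so 56 ≤ S + 2Q; on the other hand S ≤ 24, D ≤ 24 and 3Q ≤ 2D.
  S Q D : ℕ
  S = ∑[ i < 8 ] ∑[ j < 8 ] a i j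
  Q = ∑[ w < N ] (inn w * out w)
  D = ∑[ w < N ] (out w + inn w)

  S≤24 : S ≤ 24
  S≤24 = ∑-mono {f = λ i → ∑[ j < 8 ] a i j} {g = λ _ → 3}
                λ i → subst (_≤ 3) (sym (∑a-row i)) (out+inn≤3 (c i))

  -- After exchanging the sums, D is the sum of the degrees in G of the eight members.
  D≤24 : D ≤ 24
  D≤24 = subst (_≤ 24) (sym swap) (∑-mono {g = λ _ → 3} degree≤3)
    where
    swap : D ≡ ∑[ j < 8 ] ∑[ w < N ] (O w (c j) + O (c j) w)
    swap = trans (sum-cong-≗ λ w → sym (∑-distrib-+ (λ j → O w (c j)) (λ j → O (c j) w)))
                 (∑-comm λ w j → O w (c j) + O (c j) w)
    degree≤3 : ∀ j → ∑[ w < N ] (O w (c j) + O (c j) w) ≤ 3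
    degree≤3 j = subst (_≤ 3)
      (trans (∣tabulate∣ (λ w → is-just (σ (c j) w)))
             (sum-cong-≗ λ w → trans (adjacency (c j) w) (+-comm (O (c j) w) (O w (c j)))))
      (sub (c j))

  -- The product is at most 2 when the sum is at most 3. Equality holds only for 0 + 0, 1 + 2 and 2
  -- + 1, which `split` exploits later.
  pointwise : ∀ w → 3 * (inn w * out w) ≤ 2 * (out w + inn w)
  pointwise w = small (out w) (inn w) (out+inn≤3 w)
    where
    small : ∀ o i → o + i ≤ 3 → 3 * (i * o) ≤ 2 * (o + i)
    small 0 i _ rewrite *-zeroʳ i = z≤n
    small 1 0 _ = z≤n
    small 1 1 _ = n≤1+n 3
    small 1 2 _ = ≤-refl
    small 1 (suc (suc (suc _))) (s≤s (s≤s (s≤s ())))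
    small 2 0 _ = z≤n
    small 2 1 _ = ≤-refl
    small 2 (suc (suc _)) (s≤s (s≤s (s≤s ())))
    small (suc (suc (suc o))) 0 _ = z≤n
    small (suc (suc (suc o))) (suc i) (s≤s (s≤s (s≤s o+1+i≤0)))
      with () ← subst (_≤ 0) (+-suc o i) o+1+i≤0

  3Q≤2D : 3 * Q ≤ 2 * D
  3Q≤2D = begin
    3 * Q                              ≡⟨ *-distribˡ-sum 3 (λ w → inn w * out w) ⟩
    ∑[ w < N ] (3 * (inn w * out w))   ≤⟨ ∑-mono pointwise ⟩
    ∑[ w < N ] (2 * (out w + inn w))   ≡⟨ *-distribˡ-sum 2 (λ w → out w + inn w) ⟨
    2 * D                              ∎
    where open ≤-Reasoning

  paths-row : ∀ i → ∑[ j < 8 ] paths i j ≡ ∑[ w < N ] (O (c i) w * out w) + ∑[ w < N ] (O w (c i) * inn w)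
  paths-row i = begin
    ∑[ j < 8 ] paths i j
      ≡⟨ ∑-comm (λ j w → O (c i) w * O w (c j) + O (c j) w * O w (c i)) ⟩
    ∑[ w < N ] ∑[ j < 8 ] (O (c i) w * O w (c j) + O (c j) w * O w (c i))
      ≡⟨ sum-cong-≗ (λ w → trans (∑-distrib-+ (λ j → O (c i) w * O w (c j)) (λ j → O (c j) w * O w (c i)))
           (cong₂ _+_ (sym (*-distribˡ-sum (O (c i) w) (λ j → O w (c j))))
                      (trans (sym (*-distribʳ-sum (O w (c i)) (λ j → O (c j) w))) (*-comm (inn w) (O w (c i)))))) ⟩
    ∑[ w < N ] (O (c i) w * out w + O w (c i) * inn w)
      ≡⟨ ∑-distrib-+ (λ w → O (c i) w * out w) (λ w → O w (c i) * inn w) ⟩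
    ∑[ w < N ] (O (c i) w * out w) + ∑[ w < N ] (O w (c i) * inn w) ∎
    where open ≡-Reasoning

  -- For a fixed middle w, a 2-path pairs an arc from a member with an arc to a member; each of the
  -- two orders of the end points contributes Q.
  ∑paths : ∑[ i < 8 ] ∑[ j < 8 ] paths i j ≡ Q + Q
  ∑paths = begin
    ∑[ i < 8 ] ∑[ j < 8 ] paths i j
      ≡⟨ sum-cong-≗ paths-row ⟩
    ∑[ i < 8 ] (∑[ w < N ] (O (c i) w * out w) + ∑[ w < N ] (O w (c i) * inn w))
      ≡⟨ ∑-distrib-+ (λ i → ∑[ w < N ] (O (c i) w * out w)) (λ i → ∑[ w < N ] (O w (c i) * inn w)) ⟩
    ∑[ i < 8 ] ∑[ w < N ] (O (c i) w * out w) + ∑[ i < 8 ] ∑[ w < N ] (O w (c i) * inn w)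
      ≡⟨ cong₂ _+_ (∑-comm (λ i w → O (c i) w * out w)) (∑-comm (λ i w → O w (c i) * inn w)) ⟩
    ∑[ w < N ] ∑[ i < 8 ] (O (c i) w * out w) + ∑[ w < N ] ∑[ i < 8 ] (O w (c i) * inn w)
      ≡⟨ cong₂ _+_ (sum-cong-≗ λ w → sym (*-distribʳ-sum (out w) (λ i → O (c i) w)))
                   (sum-cong-≗ λ w → trans (sym (*-distribʳ-sum (inn w) (λ i → O w (c i)))) (*-comm (out w) (inn w))) ⟩
    Q + Q ∎
    where open ≡-Reasoning

  ∑T : ∑[ i < 8 ] ∑[ j < 8 ] T i j ≡ S + (Q + Q)
  ∑T = begin
    ∑[ i < 8 ] ∑[ j < 8 ] T i j
      ≡⟨ sum-cong-≗ (λ i → ∑-distrib-+ (a i) (paths i)) ⟩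
    ∑[ i < 8 ] (∑[ j < 8 ] a i j + ∑[ j < 8 ] paths i j)
      ≡⟨ ∑-distrib-+ (λ i → ∑[ j < 8 ] a i j) (λ i → ∑[ j < 8 ] paths i j) ⟩
    S + ∑[ i < 8 ] ∑[ j < 8 ] paths i j
      ≡⟨ cong (S +_) ∑paths ⟩
    S + (Q + Q) ∎
    where open ≡-Reasoning

  56≤S+2Q : 56 ≤ S + (Q + Q)
  56≤S+2Q = subst (56 ≤_) ∑T (∑-mono {f = λ i → ∑[ j < 8 ] apart i j} λ i → ∑-mono (apart≤T i))

  3Q≤48 : 3 * Q ≤ 48
  3Q≤48 = ≤-trans 3Q≤2D (*-monoʳ-≤ 2 D≤24)

  Q≤16 : Q ≤ 16
  Q≤16 = *-cancelˡ-≤ 3 3Q≤48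

  16≤Q : 16 ≤ Q
  16≤Q = *-cancelˡ-≤ 2 (+-cancelˡ-≤ 24 32 (2 * Q) (≤-trans 56≤S+2Q
           (≤-trans (+-monoˡ-≤ (Q + Q) S≤24) (≤-reflexive (cong (24 +_) (double Q))))))
    where
    double : ∀ q → q + q ≡ 2 * q
    double = solve-∀

  24≤S : 24 ≤ S
  24≤S = +-cancelʳ-≤ 32 24 S (≤-trans 56≤S+2Q (+-monoʳ-≤ S (+-mono-≤ Q≤16 Q≤16)))

  -- S = 24, Q = 16 and D = 24 are now forced, so the termwise estimates behind them are equalities.
  -- The same argument gives `balanced` and `T≡apart`.
  degree≡3 : ∀ i → out (c i) + inn (c i) ≡ 3
  degree≡3 = ∑-squeeze (out+inn≤3 ∘ c) (subst (24 ≤_) (sum-cong-≗ ∑a-row) 24≤S)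

  balanced : ∀ w → 3 * (inn w * out w) ≡ 2 * (out w + inn w)
  balanced = ∑-squeeze pointwise
    (subst₂ _≤_ (*-distribˡ-sum 2 (λ w → out w + inn w)) (*-distribˡ-sum 3 (λ w → inn w * out w))
      (≤-trans (*-monoʳ-≤ 2 D≤24) (*-monoʳ-≤ 3 16≤Q)))

  T-row : ∀ i → ∑[ j < 8 ] apart i j ≡ ∑[ j < 8 ] T i j
  T-row = ∑-squeeze (λ i → ∑-mono (apart≤T i))
    (subst (_≤ 56) (sym ∑T) (+-mono-≤ S≤24 (+-mono-≤ Q≤16 Q≤16)))

  T≡apart : ∀ i j → apart i j ≡ T i j
  T≡apart i = ∑-squeeze (apart≤T i) (≤-reflexive (sym (T-row i)))

  -- Row i of `T` adds up to 7, one for each other member; adjacencies account for 3, and 2-paths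
  -- for the rest.
  mixed : ∀ i → ∑[ w < N ] (O (c i) w * out w) + ∑[ w < N ] (O w (c i) * inn w) ≡ 4
  mixed i = +-cancelˡ-≡ 3 _ 4 (begin
    3 + (∑[ w < N ] (O (c i) w * out w) + ∑[ w < N ] (O w (c i) * inn w))
      ≡⟨ cong₂ _+_ (trans (∑a-row i) (degree≡3 i)) (paths-row i) ⟨
    ∑[ j < 8 ] a i j + ∑[ j < 8 ] paths i j
      ≡⟨ ∑-distrib-+ (a i) (paths i) ⟨
    ∑[ j < 8 ] T i j
      ≡⟨ T-row i ⟨
    ∑[ j < 8 ] apart i j
      ≡⟨ apart-row i ⟩
    7 ∎)
    where
    open ≡-Reasoning
    apart-row : ∀ i → ∑[ j < 8 ] apart i j ≡ 7
    apart-row = from-yes (all? λ i → ∑[ j < 8 ] apart i j ℕ.≟ 7)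

  closed : ∀ i {w} → Adj G (c i) w → ∃ λ j → c j ≡ w
  closed i = row≥3⇒closed sub (clique-injective G cl) {u = c i}
    (≤-reflexive (trans (sym (degree≡3 i)) (row-size (c i))))

-- A ranges over the vertices of out-degree 2; the hypotheses are invariant under
-- reversing all arcs and exchanging A and B.
module Chain {k} (M : Fin k → Fin k → Bool) (A B : Fin k → Bool)
  (A+B   : ∀ x → ⟦ A x ⟧ + ⟦ B x ⟧ ≡ 1)
  (∑A    : ∑[ x < k ] ⟦ A x ⟧ ≡ 4)
  (ins   : ∀ x → ∑[ w < k ] ⟦ M w x ⟧ ≡ 1 + ⟦ B x ⟧)
  (mix   : ∀ x → ∑[ w < k ] (⟦ M x w ⟧ * ⟦ A w ⟧) + ∑[ w < k ] (⟦ M w x ⟧ * ⟦ B w ⟧) ≡ 1)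
  (asym  : ∀ {x y} → M x y ≡ true → M y x ≡ true → ⊥)
  (no-C₃ : ∀ {x y z} → M x y ≡ true → M y z ≡ true → M z x ≡ true → ⊥)
  (no-C₄ : ∀ {x y z w} → M x y ≡ true → M y z ≡ true → M z w ≡ true → M w x ≡ true → ⊥)
  where

  private
    positive : ∀ {x} → 1 ≤ ⟦ x ⟧ → x ≡ true
    positive {true} _ = refl

    positive² : ∀ {x y} → 1 ≤ ⟦ x ⟧ * ⟦ y ⟧ → x ≡ true × y ≡ true
    positive² {true} {true} _ = refl , refl

    term : ∀ {x y} → x ≡ true → y ≡ true → 1 ≤ ⟦ x ⟧ * ⟦ y ⟧
    term refl refl = s≤s z≤n

    too-many : ∀ {s t} → 1 ≤ s → 1 ≤ t → s + t ≡ 1 → ⊥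
    too-many {suc s} {suc t} _ _ eq with () ← trans (sym (+-suc s t)) (cong ℕ.pred eq)

  -- Some t has an arc to x, as the in-degree of x is positive. If t were in B, `mix` at x would
  -- count both t and y.
  predecessor : ∀ {x y} → M x y ≡ true → A x ≡ true → A y ≡ true → ∃ λ t → M t x ≡ true × A t ≡ true
  predecessor {x} {y} xy Ax Ay
    with t , 1≤tx ← ∑-positive (λ w → ⟦ M w x ⟧) (subst (1 ≤_) (sym (ins x)) (s≤s z≤n))
    with A t in At | B t in Bt | A+B t
  ... | true  | _    | _ = t , positive 1≤tx , At
  ... | false | true | _ = contradiction (mix x)
    (too-many (≤-trans (term xy Ay) (term≤∑ (λ w → ⟦ M x w ⟧ * ⟦ A w ⟧) y))
              (≤-trans (term (positive 1≤tx) Bt) (term≤∑ (λ w → ⟦ M w x ⟧ * ⟦ B w ⟧) t)))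

  -- Otherwise `mix` at y yields an in-neighbour in B. But y is in A, so it has in-degree 1, and its
  -- in-neighbour x is in A.
  successor : ∀ {x y} → M x y ≡ true → A x ≡ true → A y ≡ true → ∃ λ z → M y z ≡ true × A z ≡ true
  successor {x} {y} xy Ax Ay with ∑[ w < k ] (⟦ M y w ⟧ * ⟦ A w ⟧) in eq
  ... | suc _ with z , 1≤ ← ∑-positive (λ w → ⟦ M y w ⟧ * ⟦ A w ⟧) (subst (1 ≤_) (sym eq) (s≤s z≤n)) =
    z , positive² 1≤
  ... | zero  = contradiction split
    (too-many (≤-trans (term xy Ax) (term≤∑ (λ w → ⟦ M w y ⟧ * ⟦ A w ⟧) x))
              (≤-reflexive (sym (trans (cong (_+ ∑[ w < k ] (⟦ M w y ⟧ * ⟦ B w ⟧)) (sym eq)) (mix y)))))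
    where
    By : ⟦ B y ⟧ ≡ 0
    By with A y | B y | A+B y
    By | true | false | _ = refl
    split : ∑[ w < k ] (⟦ M w y ⟧ * ⟦ A w ⟧) + ∑[ w < k ] (⟦ M w y ⟧ * ⟦ B w ⟧) ≡ 1
    split = begin
      ∑[ w < k ] (⟦ M w y ⟧ * ⟦ A w ⟧) + ∑[ w < k ] (⟦ M w y ⟧ * ⟦ B w ⟧)
        ≡⟨ ∑-distrib-+ (λ w → ⟦ M w y ⟧ * ⟦ A w ⟧) (λ w → ⟦ M w y ⟧ * ⟦ B w ⟧) ⟨
      ∑[ w < k ] (⟦ M w y ⟧ * ⟦ A w ⟧ + ⟦ M w y ⟧ * ⟦ B w ⟧)
        ≡⟨ sum-cong-≗ (λ w → trans (sym (*-distribˡ-+ ⟦ M w y ⟧ ⟦ A w ⟧ ⟦ B w ⟧))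
                                   (trans (cong (⟦ M w y ⟧ *_) (A+B w)) (*-identityʳ ⟦ M w y ⟧))) ⟩
      ∑[ w < k ] ⟦ M w y ⟧
        ≡⟨ trans (ins y) (cong suc By) ⟩
      1 ∎
      where open ≡-Reasoning

  five : ∀ {xs : Vec (Fin k) 5} → Unique xs → All (λ x → A x ≡ true) xs → ⊥
  five {xs} uniq all with listing id (lookup xs 0F) (tabulate A) (≤-reflexive (trans (∣tabulate∣ A) ∑A))
  ... | ys , cov , _ = n≮n 4 (covered⇒≤ (λ {i} {j} → unique⇒lookup-injective uniq i j) ys
    λ i → cov (lookup⇒[]= _ _ (trans (lookup∘tabulate A _) (lookup⁺ all i))))

  -- One step backwards and two forwards extend the arc to a path y₀ → ... → y₄ inside A. Its
  -- vertices are distinct: by `asym` when one or two steps apart, by `no-C₃` when three, by `no-C₄`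
  -- when four.
  no-arc : ∀ {x y} → M x y ≡ true → A x ≡ true → A y ≡ true → ⊥
  no-arc {y₁} {y₂} e₁ A₁ A₂
    with y₀ , e₀ , A₀ ← predecessor e₁ A₁ A₂
    with y₃ , e₂ , A₃ ← successor e₁ A₁ A₂
    with y₄ , e₃ , A₄ ← successor e₂ A₂ A₃
    = five
      ( (irrefl e₀ ∷ skip e₀ e₁ ∷ (λ { refl → no-C₃ e₀ e₁ e₂ }) ∷ (λ { refl → no-C₄ e₀ e₁ e₂ e₃ }) ∷ [])
      ∷ (irrefl e₁ ∷ skip e₁ e₂ ∷ (λ { refl → no-C₃ e₁ e₂ e₃ }) ∷ [])
      ∷ (irrefl e₂ ∷ skip e₂ e₃ ∷ [])
      ∷ (irrefl e₃ ∷ [])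
      ∷ [] ∷ [])
      (A₀ ∷ A₁ ∷ A₂ ∷ A₃ ∷ A₄ ∷ [])
    where
    irrefl : ∀ {x y} → M x y ≡ true → x ≢ y
    irrefl e refl = asym e e
    skip : ∀ {x y z} → M x y ≡ true → M y z ≡ true → x ≢ z
    skip e e′ refl = asym e e′

-- The middle of a directed 2-path between x in A and y in B lies in A or in B, so one of its arcs
-- would stay inside a class. Hence x is adjacent to all four vertices of B.
¬bipartite : ∀ {k} (M : Fin k → Fin k → Bool) (A B : Fin k → Bool) →
  (∀ x → ⟦ A x ⟧ + ⟦ B x ⟧ ≡ 1) → ∑[ x < k ] ⟦ A x ⟧ ≡ 4 → ∑[ x < k ] ⟦ B x ⟧ ≡ 4 →
  (∀ x → ∑[ y < k ] (⟦ M x y ⟧ + ⟦ M y x ⟧) ≡ 3) →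
  (∀ {x y} → M x y ≡ true → A x ≡ true → A y ≡ true → ⊥) →
  (∀ {x y} → M x y ≡ true → B x ≡ true → B y ≡ true → ⊥) →
  (∀ x y → x ≢ y → (M x y ≡ true ⊎ M y x ≡ true) ⊎
                   ((∃ λ w → M x w ≡ true × M w y ≡ true) ⊎ (∃ λ w → M y w ≡ true × M w x ≡ true))) → ⊥
¬bipartite {k} M A B A+B ∑A ∑B degree no-AA no-BB join =
  let x , 1≤Ax = ∑-positive (λ x → ⟦ A x ⟧) (subst (1 ≤_) (sym ∑A) (s≤s z≤n)) in
  from-no (4 ℕ.≤? 3) (begin
    4                                     ≡⟨ ∑B ⟨
    ∑[ y < k ] ⟦ B y ⟧                    ≤⟨ ∑-mono (λ y → adjacent x y (true? 1≤Ax)) ⟩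
    ∑[ y < k ] (⟦ M x y ⟧ + ⟦ M y x ⟧)    ≡⟨ degree x ⟩
    3                                     ∎)
  where
  open ≤-Reasoning
  true? : ∀ {b} → 1 ≤ ⟦ b ⟧ → b ≡ true
  true? {true} _ = refl
  sides : ∀ w → A w ≡ true ⊎ B w ≡ true
  sides w with A w | B w | A+B w
  ... | true  | _    | _ = inj₁ refl
  ... | false | true | _ = inj₂ refl
  exclusive : ∀ {x} → A x ≡ true → B x ≡ true → ⊥
  exclusive {x} p q with () ← trans (sym (cong₂ (λ a b → ⟦ a ⟧ + ⟦ b ⟧) p q)) (A+B x)
  adjacent : ∀ x y → A x ≡ true → ⟦ B y ⟧ ≤ ⟦ M x y ⟧ + ⟦ M y x ⟧
  adjacent x y Ax with B y in By
  ... | false = z≤n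
  ... | true with join x y (λ { refl → exclusive Ax By })
  ... | inj₁ (inj₁ p) rewrite p = s≤s z≤n
  ... | inj₁ (inj₂ p) rewrite p = m≤n+m 1 ⟦ M x y ⟧
  ... | inj₂ (inj₁ (w , p , q)) = contradiction (sides w) [ no-AA p Ax , (λ Bw → no-BB q Bw By) ]′
  ... | inj₂ (inj₂ (w , p , q)) = contradiction (sides w) [ (λ Aw → no-AA q Aw Ax) , no-BB p By ]′

-- The counting is applied twice. In G it shows that the clique is closed under neighbours, so the
-- induced graph is again a clique; there sums over vertices and sums over members coincide.
module SpanningClique (G : MixedGraph 1 0) (sub : Subcubic (und G))
                      (c : Fin 8 → V G) (cl : Clique G c) where
  private module E = EightClique G sub c cl
  open Rows G c using (induced; induced-subcubic; induced-clique)

  cl′ : Clique induced id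
  cl′ = induced-clique E.closed cl

  open Arcs induced renaming (_⇒_ to M)
  open EightClique induced (induced-subcubic sub (clique-injective G cl)) id cl′

  A B : Fin 8 → Bool
  A x = does (out x ℕ.≟ 2)
  B   = not ∘ A

  -- The degrees add up to 3 and `balanced` excludes 0 + 3, which leaves 1 and 2 in some order.
  split : ∀ x → out x ≡ 1 + ⟦ A x ⟧ × inn x ≡ 1 + ⟦ B x ⟧
  split x = small (out x) (inn x) (degree≡3 x) (balanced x)
    where
    small : ∀ o i → o + i ≡ 3 → 3 * (i * o) ≡ 2 * (o + i) →
            o ≡ 1 + ⟦ does (o ℕ.≟ 2) ⟧ × i ≡ 1 + ⟦ not (does (o ℕ.≟ 2)) ⟧
    small 0 _ refl ()
    small 1 _ refl _ = refl , refl
    small 2 _ refl _ = refl , refl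
    small 3 _ refl ()

  A+B : ∀ x → ⟦ A x ⟧ + ⟦ B x ⟧ ≡ 1
  A+B x with A x
  ... | true  = refl
  ... | false = refl

  halves : ∀ p q → 8 + p ≡ 8 + q → p + q ≡ 8 → p ≡ 4
  halves p q eq p+q≡8 with refl ← +-cancelˡ-≡ 8 p q eq = *-cancelˡ-≡ p 4 2 (trans (double p) p+q≡8)
    where
    double : ∀ p → 2 * p ≡ p + p
    double = solve-∀

  ∑A+∑B : ∑[ x < 8 ] ⟦ A x ⟧ + ∑[ x < 8 ] ⟦ B x ⟧ ≡ 8
  ∑A+∑B = trans (sym (∑-distrib-+ (λ x → ⟦ A x ⟧) (λ x → ⟦ B x ⟧))) (sum-cong-≗ {y = λ _ → 1} A+B)

  -- Both sides count all arcs, by tail and by head.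
  handshake : 8 + ∑[ x < 8 ] ⟦ A x ⟧ ≡ 8 + ∑[ x < 8 ] ⟦ B x ⟧
  handshake = begin
    8 + ∑[ x < 8 ] ⟦ A x ⟧      ≡⟨ ∑-distrib-+ (λ _ → 1) (λ x → ⟦ A x ⟧) ⟨
    ∑[ x < 8 ] (1 + ⟦ A x ⟧)    ≡⟨ sum-cong-≗ (proj₁ ∘ split) ⟨
    ∑[ x < 8 ] out x            ≡⟨ ∑-comm O ⟩
    ∑[ x < 8 ] inn x            ≡⟨ sum-cong-≗ (proj₂ ∘ split) ⟩
    ∑[ x < 8 ] (1 + ⟦ B x ⟧)    ≡⟨ ∑-distrib-+ (λ _ → 1) (λ x → ⟦ B x ⟧) ⟩
    8 + ∑[ x < 8 ] ⟦ B x ⟧      ∎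
    where open ≡-Reasoning

  ∑A : ∑[ x < 8 ] ⟦ A x ⟧ ≡ 4
  ∑A = halves _ _ handshake ∑A+∑B

  ∑B : ∑[ x < 8 ] ⟦ B x ⟧ ≡ 4
  ∑B = halves _ _ (sym handshake) (trans (+-comm (∑[ x < 8 ] ⟦ B x ⟧) _) ∑A+∑B)

  -- By `split`, each `out w` and `inn w` in `mixed` is 1 plus an indicator; the ones add up to the
  -- degree 3, leaving 4 - 3 = 1.
  mix : ∀ x → ∑[ w < 8 ] (O x w * ⟦ A w ⟧) + ∑[ w < 8 ] (O w x * ⟦ B w ⟧) ≡ 1
  mix x = +-cancelˡ-≡ 3 _ 1 (begin
    3 + (∑[ w < 8 ] (O x w * ⟦ A w ⟧) + ∑[ w < 8 ] (O w x * ⟦ B w ⟧))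
      ≡⟨ cong (_+ (∑[ w < 8 ] (O x w * ⟦ A w ⟧) + ∑[ w < 8 ] (O w x * ⟦ B w ⟧))) (degree≡3 x) ⟨
    (out x + inn x) + (∑[ w < 8 ] (O x w * ⟦ A w ⟧) + ∑[ w < 8 ] (O w x * ⟦ B w ⟧))
      ≡⟨ interchange (out x) (inn x) _ _ ⟩
    (out x + ∑[ w < 8 ] (O x w * ⟦ A w ⟧)) + (inn x + ∑[ w < 8 ] (O w x * ⟦ B w ⟧))
      ≡⟨ cong₂ _+_ (∑-distrib-+ (O x) (λ w → O x w * ⟦ A w ⟧))
                   (∑-distrib-+ (λ w → O w x) (λ w → O w x * ⟦ B w ⟧)) ⟨
    ∑[ w < 8 ] (O x w + O x w * ⟦ A w ⟧) + ∑[ w < 8 ] (O w x + O w x * ⟦ B w ⟧)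
      ≡⟨ cong₂ _+_ (sum-cong-≗ λ w → trans (sym (*-suc (O x w) ⟦ A w ⟧)) (cong (O x w *_) (sym (proj₁ (split w)))))
                   (sum-cong-≗ λ w → trans (sym (*-suc (O w x) ⟦ B w ⟧)) (cong (O w x *_) (sym (proj₂ (split w))))) ⟩
    ∑[ w < 8 ] (O x w * out w) + ∑[ w < 8 ] (O w x * inn w)
      ≡⟨ mixed x ⟩
    4 ∎)
    where
    open ≡-Reasoning
    interchange : ∀ p q r s → (p + q) + (r + s) ≡ (p + r) + (q + s)
    interchange = solve-∀

  apart≤1 : ∀ x y → apart x y ≤ 1
  apart≤1 x y with x ≟ y
  ... | yes _ = z≤n
  ... | no  _ = s≤s z≤n

  paths-split : ∀ x z → paths x z ≡ ∑[ w < 8 ] (O x w * O w z) + ∑[ w < 8 ] (O z w * O w x)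
  paths-split x z = ∑-distrib-+ (λ w → O x w * O w z) (λ w → O z w * O w x)

  count : ∀ {x y z} → M x y ≡ true → M y z ≡ true → 1 ≤ ∑[ w < 8 ] (O x w * O w z)
  count {x} {y} {z} p q = ≤-trans step (term≤∑ (λ w → O x w * O w z) y)
    where
    step : 1 ≤ O x y * O y z
    step rewrite p | q = s≤s z≤n

  -- The pair x, z would be counted twice in `T`, by an arc and by a 2-path.
  no-C₃ : ∀ {x y z} → M x y ≡ true → M y z ≡ true → M z x ≡ true → ⊥
  no-C₃ {x} {y} {z} p q r = n≮n 1 (begin
    1 + 1             ≤⟨ +-mono-≤ adjacent path ⟩
    T x z             ≡⟨ T≡apart x z ⟨
    apart x z         ≤⟨ apart≤1 x z ⟩
    1                 ∎)
    where
    open ≤-Reasoning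
    adjacent : 1 ≤ a x z
    adjacent rewrite r = m≤n+m 1 (O x z)
    path : 1 ≤ paths x z
    path = subst (1 ≤_) (sym (paths-split x z)) (≤-trans (count p q) (m≤m+n _ _))

  -- The pair x, z would be counted twice in `T`, by 2-paths in opposite directions.
  no-C₄ : ∀ {x y z w} → M x y ≡ true → M y z ≡ true → M z w ≡ true → M w x ≡ true → ⊥
  no-C₄ {x} {y} {z} {w} p q r s = n≮n 1 (begin
    1 + 1             ≤⟨ +-mono-≤ (count p q) (count r s) ⟩
    _                 ≡⟨ paths-split x z ⟨
    paths x z         ≤⟨ m≤n+m (paths x z) (a x z) ⟩
    T x z             ≡⟨ T≡apart x z ⟨
    apart x z         ≤⟨ apart≤1 x z ⟩
    1                 ∎)
    where open ≤-Reasoning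

  no-AA : ∀ {x y} → M x y ≡ true → A x ≡ true → A y ≡ true → ⊥
  no-AA = Chain.no-arc M A B A+B ∑A (proj₂ ∘ split) mix arc-asym no-C₃ no-C₄

  no-BB : ∀ {x y} → M x y ≡ true → B x ≡ true → B y ≡ true → ⊥
  no-BB xy Bx By = Chain.no-arc (λ x y → M y x) B A
    (λ x → trans (+-comm ⟦ B x ⟧ ⟦ A x ⟧) (A+B x)) ∑B (proj₁ ∘ split)
    (λ x → trans (+-comm (∑[ w < 8 ] (O w x * ⟦ B w ⟧)) _) (mix x))
    arc-asym (λ p q r → no-C₃ r q p) (λ p q r s → no-C₄ s r q p) xy By Bx

  impossible : ⊥
  impossible = ¬bipartite M A B A+B ∑A ∑B (λ x → trans (∑a-row x) (degree≡3 x)) no-AA no-BB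
    (λ x y x≢y → joined⇒ (cl′ x y x≢y))

bound₇ : CliqueBound 1 0 7
bound₇ = noClique⇒bound SpanningClique.impossible

-- Examples

incidence : ∀ {k} → List (Fin k × Fin k × Label m n) → Fin k → Fin k → Maybe (Label m n)
incidence [] u v = nothing
incidence ((a , b , l) ∷ es) u v with (u ≟ a) ×-dec (v ≟ b) | (u ≟ b) ×-dec (v ≟ a)
... | yes _ | _     = just l
... | no  _ | yes _ = just (reverse l)
... | no  _ | no  _ = incidence es u v

Valid : ∀ {k} → List (Fin k × Fin k × Label m n) → Set
Valid es = (∀ u → incidence es u u ≡ nothing) ×
           (∀ u v → incidence es v u ≡ Maybe.map reverse (incidence es u v))

valid? : ∀ {k} (es : List (Fin k × Fin k × Label m n)) → Dec (Valid es)
valid? es = all? (λ u → ≡-dec _≟ᴸ_ (incidence es u u) nothing) ×-dec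
            all? (λ u → all? λ v → ≡-dec _≟ᴸ_ (incidence es v u) (Maybe.map reverse (incidence es u v)))

graph : ∀ {k} (es : List (Fin k × Fin k × Label m n)) → {True (valid? es)} → MixedGraph m n
graph {k = k} es {valid} = record
  { order      = k
  ; σ          = incidence es
  ; σ-loopless = proj₁ (toWitness valid)
  ; σ-reverse  = proj₂ (toWitness valid)
  }

SubcubicClique : MixedGraph m n → Set
SubcubicClique G = Subcubic (und G) × (∀ u v → u ≡ v ⊎ Joined G u v)

subcubicClique? : (G : MixedGraph m n) → Dec (SubcubicClique G)
subcubicClique? G =
  all? (λ u → SimpleGraph.degree (und G) u ≤? 3) ×-dec
  all? (λ u → all? λ v → (u ≟ v) ⊎-dec joined? G u v)

-- Transport of examples to larger label sets

relabelᴸ : ∀ {m₀ n₀} → m₀ ≤ m → n₀ ≤ n → Label m₀ n₀ → Label m n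
relabelᴸ m₀≤m n₀≤n (arc⁺ k) = arc⁺ (inject≤ k m₀≤m)
relabelᴸ m₀≤m n₀≤n (arc⁻ k) = arc⁻ (inject≤ k m₀≤m)
relabelᴸ m₀≤m n₀≤n (edge k) = edge (inject≤ k n₀≤n)

relabelᴸ-injective : ∀ {m₀ n₀} (m₀≤m : m₀ ≤ m) (n₀≤n : n₀ ≤ n) {k l : Label m₀ n₀} →
                     relabelᴸ m₀≤m n₀≤n k ≡ relabelᴸ m₀≤m n₀≤n l → k ≡ l
relabelᴸ-injective p q {arc⁺ j} {arc⁺ k} eq = cong arc⁺ (inject≤-injective p p j k (arc⁺-injective eq))
  where
  arc⁺-injective : ∀ {i j} → arc⁺ {m} {n} i ≡ arc⁺ j → i ≡ j
  arc⁺-injective refl = refl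
relabelᴸ-injective p q {arc⁻ j} {arc⁻ k} eq = cong arc⁻ (inject≤-injective p p j k (arc⁻-injective eq))
  where
  arc⁻-injective : ∀ {i j} → arc⁻ {m} {n} i ≡ arc⁻ j → i ≡ j
  arc⁻-injective refl = refl
relabelᴸ-injective p q {edge j} {edge k} eq = cong edge (inject≤-injective q q j k (edge-injective eq))
  where
  edge-injective : ∀ {i j} → edge {m} {n} i ≡ edge j → i ≡ j
  edge-injective refl = refl

relabelᴸ-reverse : ∀ {m₀ n₀} (m₀≤m : m₀ ≤ m) (n₀≤n : n₀ ≤ n) (l : Label m₀ n₀) →
                   relabelᴸ m₀≤m n₀≤n (reverse l) ≡ reverse (relabelᴸ m₀≤m n₀≤n l)
relabelᴸ-reverse p q (arc⁺ _) = refl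
relabelᴸ-reverse p q (arc⁻ _) = refl
relabelᴸ-reverse p q (edge _) = refl

module Relabel {m₀ n₀} (m₀≤m : m₀ ≤ m) (n₀≤n : n₀ ≤ n) (G : MixedGraph m₀ n₀) where
  open MixedGraph G using (σ; σ-loopless; σ-reverse)

  φ : Label m₀ n₀ → Label m n
  φ = relabelᴸ m₀≤m n₀≤n

  relabel : MixedGraph m n
  relabel = record
    { order      = order G
    ; σ          = λ u v → Maybe.map φ (σ u v)
    ; σ-loopless = λ u → cong (Maybe.map φ) (σ-loopless u)
    ; σ-reverse  = λ u v → trans (cong (Maybe.map φ) (σ-reverse u v)) (map-reverse (σ u v))
    }
    where
    map-reverse : ∀ x → Maybe.map φ (Maybe.map reverse x) ≡ Maybe.map reverse (Maybe.map φ x)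
    map-reverse (just l) = cong just (relabelᴸ-reverse m₀≤m n₀≤n l)
    map-reverse nothing  = refl

  relabel-joined : ∀ {u v} → Joined G u v → Joined relabel u v
  relabel-joined (inj₁ (l , eq)) = inj₁ (φ l , cong (Maybe.map φ) eq)
  relabel-joined (inj₂ (w , k , l , p , q , k≢l)) =
    inj₂ (w , φ k , φ l , cong (Maybe.map φ) p , cong (Maybe.map φ) q
         , k≢l ∘ relabelᴸ-injective m₀≤m n₀≤n)

  relabel-subcubic : Subcubic (und G) → Subcubic (und relabel)
  relabel-subcubic sub u = subst (λ S → ∣ S ∣ ≤ 3) (sym (tabulate-cong λ v → is-just-map (σ u v))) (sub u)
    where
    is-just-map : ∀ x → is-just (Maybe.map φ x) ≡ is-just x
    is-just-map (just _) = refl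
    is-just-map nothing  = refl

-- The example is checked by evaluation with few labels, then relabelled: an injective relabelling
-- keeps adjacencies and keeps different labels different.
attained : ∀ {m₀ n₀} (m₀≤m : m₀ ≤ m) (n₀≤n : n₀ ≤ n) (G : MixedGraph m₀ n₀) {_ : True (subcubicClique? G)} →
  CliqueBound m n (order G) → ω-a[ m , n ] Subcubic (order G) × ω-r[ m , n ] Subcubic (order G)
attained m₀≤m n₀≤n G {good} bound with toWitness good
... | sub , join = cliqueNumbers bound relabel refl (relabel-subcubic sub)
      λ u v u≢v → [ (λ u≡v → contradiction u≡v u≢v) , relabel-joined ]′ (join u v)
  where open Relabel m₀≤m n₀≤n G

oriented₇ : MixedGraph 1 0
oriented₇ = graph {k = 7}
  ( (3F , 0F , a) ∷ (4F , 0F , a) ∷ (0F , 5F , a) ∷ (2F , 1F , a) ∷ (1F , 3F , a) ∷ (6F , 1F , a)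
  ∷ (2F , 4F , a) ∷ (6F , 2F , a) ∷ (3F , 4F , a) ∷ (5F , 6F , a) ∷ [])
  where
  a : Label 1 0
  a = arc⁺ 0F

-- A cubic graph of diameter 2; it serves n = 3 as well.
twoColoured₈ : MixedGraph 0 2
twoColoured₈ = graph {k = 8}
  ( (0F , 1F , edge 0F) ∷ (0F , 2F , edge 1F) ∷ (0F , 5F , edge 1F) ∷ (1F , 6F , edge 0F)
  ∷ (1F , 7F , edge 1F) ∷ (2F , 3F , edge 1F) ∷ (2F , 6F , edge 0F) ∷ (3F , 5F , edge 0F)
  ∷ (3F , 7F , edge 0F) ∷ (4F , 5F , edge 0F) ∷ (4F , 6F , edge 1F) ∷ (4F , 7F , edge 1F) ∷ [])

-- Vertices 0 to 4 form the outer pentagon, 5 to 9 the inner pentagram. Non-adjacent vertices of the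
-- Petersen graph have exactly one common neighbour, so all pairs are joined exactly when every
-- vertex sees three different labels.
petersen : (outer inner spoke : Fin 5 → Label m n) → List (Fin 10 × Fin 10 × Label m n)
petersen outer inner spoke =
    (0F , 1F , outer 0F) ∷ (1F , 2F , outer 1F) ∷ (2F , 3F , outer 2F) ∷ (3F , 4F , outer 3F) ∷ (4F , 0F , outer 4F)
  ∷ (5F , 7F , inner 0F) ∷ (6F , 8F , inner 1F) ∷ (7F , 9F , inner 2F) ∷ (8F , 5F , inner 3F) ∷ (9F , 6F , inner 4F)
  ∷ (0F , 5F , spoke 0F) ∷ (1F , 6F , spoke 1F) ∷ (2F , 7F , spoke 2F) ∷ (3F , 8F , spoke 3F) ∷ (4F , 9F , spoke 4F)
  ∷ []

-- Both 5-cycles are directed, so every vertex sees an arc in, an arc out and an edge.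
petersen₁₁ : MixedGraph 1 1
petersen₁₁ = graph (petersen (λ _ → arc⁺ 0F) (λ _ → arc⁺ 0F) (λ _ → edge 0F))

petersen₂₀ : MixedGraph 2 0
petersen₂₀ = graph (petersen (λ _ → arc⁺ 0F) (λ _ → arc⁺ 0F) (λ _ → arc⁺ 1F))

-- A proper edge colouring; the Petersen graph has none with three colours.
petersen₀₄ : MixedGraph 0 4
petersen₀₄ = graph (petersen
  (edge ∘ lookup (0F ∷ 1F ∷ 0F ∷ 1F ∷ 2F ∷ []))
  (edge ∘ lookup (0F ∷ 0F ∷ 1F ∷ 3F ∷ 3F ∷ []))
  (edge ∘ lookup (1F ∷ 2F ∷ 2F ∷ 2F ∷ 0F ∷ [])))

theorem4p1 : (m n : ℕ) → (m , n) ≢ (0 , 1) →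
    ((m , n) ≡ (1 , 0) → ω-a[ m , n ] Subcubic 7 × ω-r[ m , n ] Subcubic 7)
    × (m ≡ 0 × (n ≡ 2 ⊎ n ≡ 3) → ω-a[ m , n ] Subcubic 8 × ω-r[ m , n ] Subcubic 8)
    × ((m , n) ≡ (1 , 1) ⊎ 4 ≤ 2 * m + n → ω-a[ m , n ] Subcubic 10 × ω-r[ m , n ] Subcubic 10)
theorem4p1 m n _ =
    (λ { refl → attained ≤-refl ≤-refl oriented₇ bound₇ })
  , (λ { (refl , inj₁ refl) → attained ≤-refl ≤-refl twoColoured₈ (bound₈ (n≤1+n 2))
       ; (refl , inj₂ refl) → attained ≤-refl (n≤1+n 2) twoColoured₈ (bound₈ ≤-refl) })
  , λ { (inj₁ refl) → attained ≤-refl ≤-refl petersen₁₁ bound₁₀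
      ; (inj₂ 4≤) → many m n 4≤ }
  where
  -- Every such pair dominates (0, 4), (1, 1) or (2, 0) componentwise; (1, 0) is excluded because 2
  -- · 1 + 0 = 2.
  many : ∀ m n → 4 ≤ 2 * m + n → ω-a[ m , n ] Subcubic 10 × ω-r[ m , n ] Subcubic 10
  many 0             n       4≤n = attained z≤n 4≤n petersen₀₄ bound₁₀
  many (suc m)       (suc n) _   = attained (s≤s z≤n) (s≤s z≤n) petersen₁₁ bound₁₀
  many (suc (suc m)) 0       _   = attained (s≤s (s≤s z≤n)) z≤n petersen₂₀ bound₁₀
  many 1             0       (s≤s (s≤s ()))
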